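{- For every integer $d\geq 3$ and every odd integer $g\geq 7$ there exist infinitely many mutually rigid $d$-regular graphs of odd girth $g$.
   Context: All graphs are finite, simple and undirected. A homomorphism between graphs is a map of vertex sets sending edges to edges. A graph is rigid if its only endomorphism is the identity. A family of graphs is mutually rigid if every member is rigid and there is no homomorphism between two different members of the family. The odd girth of a graph is the length of its shortest odd cycle. -}

module Defs where

open import Data.Nat using (ℕ; zero; suc; _+_; _*_; _≤_)
open import Data.Empty using (⊥)
open import Data.Bool using (Bool; true; false)
open import Data.Fin using (Fin; zero; suc; fromℕ; inject₁)
open import Data.List using (length; filterᵇ; allFin)
open import Data.Product using (Σ; ∃; _×_)
open import Relation.Binary.PropositionalEquality using (_≡_; _≢_)
open import Relation.Nullary using (¬_)
open import Function.Definitions using (Injective)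

record Graph : Set where
  field
    n     : ℕ
    adj   : Fin n → Fin n → Bool
    sym   : ∀ i j → adj i j ≡ adj j i
    loopless : ∀ i → adj i i ≡ false
open Graph public

Edge : (G : Graph) → Fin (n G) → Fin (n G) → Set
Edge G x y = adj G x y ≡ true

degree : (G : Graph) → Fin (n G) → ℕ
degree G x = length (filterᵇ (adj G x) (allFin (n G)))

Regular : ℕ → Graph → Set
Regular d G = ∀ x → degree G x ≡ d

IsHom : (G H : Graph) → (Fin (n G) → Fin (n H)) → Set
IsHom G H f = ∀ x y → Edge G x y → Edge H (f x) (f y)

Hom : Graph → Graph → Set
Hom G H = Σ (Fin (n G) → Fin (n H)) (IsHom G H)

Rigid : Graph → Set
Rigid G = ∀ (f : Fin (n G) → Fin (n G)) → IsHom G G f → ∀ x → f x ≡ x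

HasCycleOfLength : Graph → ℕ → Set
HasCycleOfLength G zero = ⊥
HasCycleOfLength G (suc m) =
  3 ≤ suc m ×
  Σ (Fin (suc m) → Fin (n G)) λ v →
    Injective _≡_ _≡_ v ×
    (∀ (i : Fin m) → Edge G (v (inject₁ i)) (v (suc i))) ×
    Edge G (v (fromℕ m)) (v zero)

Odd : ℕ → Set
Odd k = ∃ λ m → k ≡ suc (2 * m)

OddGirth : Graph → ℕ → Set
OddGirth G g =
  (Odd g × HasCycleOfLength G g) ×
  (∀ k → Odd k → HasCycleOfLength G k → g ≤ k)

MutuallyRigid : (ℕ → Graph) → Set
MutuallyRigid G =
  (∀ i → Rigid (G i)) × (∀ i j → i ≢ j → ¬ Hom (G i) (G j))

{-# OPTIONS --safe #-}
module Submission where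

-- Write d = e + 1 and g = 2r + 3, and put q = re + 1 and p = 2q + e. The circular clique A on ℤ/p, in
-- which x is joined to x + q, …, x + q + e, is d-regular of odd girth g. It is almost rigid: for
-- 1 ≤ t ≤ e the vertices w and w + t are joined by a walk of length g - 2, so a homomorphism into a graph
-- of odd girth g separates them; as y and y + 1 have e common neighbours, their images are again
-- consecutive, and all homomorphisms A → A are rotations and reflections. This survives the
-- deletion of the two chords {0, q + e - 1} and {1, q + e}.
--
-- The graphs of the theorem are lifts of A: the sheets are the elements of Fin n, the two chords
-- permute the sheets by fixed-point-free permutations, and all other edges stay in their sheet. A lift
-- of A has no shorter odd cycles. A homomorphism between two such lifts acts on every sheet by a rotation or
-- a reflection that preserves the pair of chords, and so induces a map between the sets of sheets
-- that commutes with the permutations up to exchanging and inverting them (for d = 3, neighbouring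
-- sheets can also be folded onto each other). The permutations are chosen such that only the identity does so.

open import Defs hiding (n; sym)
open import Data.Bool using (Bool; true; false; not; _xor_)
open import Data.Bool.Properties using (T?; T-≡; ¬-not)
import Data.Bool.Properties as Bool
open import Data.Empty using (⊥; ⊥-elim)
open import Data.Fin using (Fin; zero; suc; toℕ; fromℕ; fromℕ<; inject₁; combine; remQuot)
import Data.Fin as Fin
open import Data.Fin.Induction using (<-weakInduction)
open import Data.Fin.Patterns
open import Data.Fin.Properties
  using (any?; toℕ<n; toℕ-fromℕ<; toℕ-fromℕ; toℕ-inject₁; toℕ-injective; injective⇒≤;
         remQuot-combine; combine-remQuot)
open import Data.Fin.Relation.Unary.Top using (view; ‵fromℕ; ‵inject₁)
open import Data.List using ([]; _∷_; filterᵇ; allFin; tabulate)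
open import Data.List.Membership.Propositional using (_∈_)
open import Data.List.Membership.Propositional.Properties
  using (∈-filter⁺; ∈-filter⁻; ∈-allFin; ∈-tabulate⁺; ∈-tabulate⁻)
open import Data.List.Membership.Propositional.Properties.WithK using (unique∧set⇒bag)
open import Data.List.Properties using (length-tabulate)
open import Data.List.Relation.Binary.BagAndSetEquality using (∼bag⇒↭)
open import Data.List.Relation.Binary.Permutation.Propositional.Properties using (↭-length)
open import Data.List.Relation.Unary.Unique.Propositional.Properties using (allFin⁺; tabulate⁺; filter⁺)
open import Data.Nat using (ℕ; zero; suc; pred; _+_; _*_; _∸_; _≤_; _<_; _≟_; z≤n; s≤s; s≤s⁻¹; NonZero)
open import Data.Nat.DivMod using (_%_; _/_; _mod_; m≡m%n+[m/n]*n; m%n<n; [m+kn]%n≡m%n; m<n⇒m%n≡m)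
open import Data.Nat.Properties hiding (_≟_)
open import Data.Nat.Tactic.RingSolver using (solve; solve-∀)
open import Data.Product using (Σ; ∃; _×_; _,_; proj₁; proj₂)
open import Data.Sum using (_⊎_; inj₁; inj₂; [_,_]′; map₂)
open import Function using (_∋_; _∘_; case_of_; mk⇔; Equivalence)
open import Function.Definitions using (Injective)
open import Relation.Binary.Definitions using (tri<; tri≈; tri>)
open import Relation.Binary.PropositionalEquality
  using (_≡_; _≢_; refl; sym; trans; cong; cong₂; subst; subst₂; module ≡-Reasoning)
open import Relation.Nullary using (Dec; yes; no; ¬_)
open import Relation.Nullary.Decidable
  using (⌊_⌋; toWitness; fromWitness; decidable-stable; map′; _×-dec_; _⊎-dec_)

-- Linear arithmetic and congruences

infixl 4 _⊕_ _⊹_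

_⊕_ : ∀ {a b c d} → a ≤ b → c ≤ d → a + c ≤ b + d
_⊕_ = +-mono-≤

_⊹_ : ∀ {a b c d} → a ≡ b → c ≡ d → a + c ≡ b + d
_⊹_ = cong₂ _+_

-- Certificates: l ≤ r is a sum of hypotheses, w a slack, and the ring solver checks the equation.
linear-≤ : ∀ {a b l r} → l ≤ r → (w : ℕ) → a + r + w ≡ b + l → a ≤ b
linear-≤ {a} {b} {l} {r} l≤r w eq = +-cancelʳ-≤ l a b
  (≤-trans (+-monoʳ-≤ a l≤r) (≤-trans (m≤m+n (a + r) w) (≤-reflexive eq)))

linear-⊥ : ∀ {l r} → l ≤ r → (w : ℕ) → 1 + r + w ≡ 0 + l → ⊥
linear-⊥ l≤r w eq = 1+n≰n (linear-≤ {1} {0} l≤r w eq)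

linear-≡ : ∀ {a b l r} → l ≡ r → a + r ≡ b + l → a ≡ b
linear-≡ {a} {b} {l} refl eq = +-cancelʳ-≡ l a b eq

module Congruence (p : ℕ) where

  infix 4 _≈_
  infixl 4 _⊞_

  -- Allowing multiples of `p` on both sides avoids subtraction, so that congruences can be added up
  -- like equations and the ring solver can check the result.
  data _≈_ (x y : ℕ) : Set where
    modulo : ∀ s t → x + s * p ≡ y + t * p → x ≈ y

  ≈-refl : ∀ {x} → x ≈ x
  ≈-refl = modulo 0 0 refl

  ≈-reflexive : ∀ {x y} → x ≡ y → x ≈ y
  ≈-reflexive refl = ≈-refl

  ≈-sym : ∀ {x y} → x ≈ y → y ≈ x
  ≈-sym (modulo s t eq) = modulo t s (sym eq)

  _⊞_ : ∀ {a b c d} → a ≈ b → c ≈ d → a + c ≈ b + d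
  _⊞_ {a} {b} {c} {d} (modulo s t eq) (modulo s′ t′ eq′) = modulo (s + s′) (t + t′)
    (linear-≡ (eq ⊹ eq′) (solve (a ∷ c ∷ s ∷ s′ ∷ p ∷ b ∷ d ∷ t ∷ t′ ∷ [])))

  linear-≈ : ∀ {a b l r} → l ≈ r → a + r ≡ b + l → a ≈ b
  linear-≈ {a} {b} {l} {r} (modulo s t eq) eq′ = modulo s t
    (linear-≡ (eq ⊹ eq′) (solve (a ∷ s ∷ p ∷ b ∷ t ∷ l ∷ r ∷ [])))

  ≈-trans : ∀ {x y z} → x ≈ y → y ≈ z → x ≈ z
  ≈-trans {x} {y} {z} x≈y y≈z = linear-≈ (x≈y ⊞ y≈z) (solve (x ∷ z ∷ y ∷ []))

  multiple-≈ : ∀ k {x y} → x ≈ y → k * x ≈ k * y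
  multiple-≈ k {x} {y} (modulo s t eq) = modulo (k * s) (k * t) (begin
    k * x + k * s * p  ≡⟨ solve (k ∷ x ∷ s ∷ p ∷ []) ⟩
    k * (x + s * p)    ≡⟨ cong (k *_) eq ⟩
    k * (y + t * p)    ≡⟨ solve (k ∷ y ∷ t ∷ p ∷ []) ⟩
    k * y + k * t * p  ∎)
    where open ≡-Reasoning

  ≈⇒≡ : ∀ {x y} → x ≈ y → x < y + p → y < x + p → x ≡ y
  ≈⇒≡ {x} {y} (modulo s t eq) x<y+p y<x+p with <-cmp s t
  ... | tri≈ _ refl _ = +-cancelʳ-≡ (s * p) x y eq
  ... | tri< s<t _ _ = ⊥-elim (linear-⊥ (x<y+p ⊕ (≤-reflexive (sym eq)) ⊕
      ((suc s * p ≤ t * p) ∋ *-monoˡ-≤ p s<t)) 0 (solve (x ∷ y ∷ p ∷ s ∷ t ∷ [])))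
  ... | tri> _ _ t<s = ⊥-elim (linear-⊥ (y<x+p ⊕ (≤-reflexive eq) ⊕ ((suc t * p ≤ s * p) ∋ *-monoˡ-≤ p t<s)) 0
      (solve (y ∷ x ∷ p ∷ s ∷ t ∷ [])))

  module _ .{{_ : NonZero p}} where

    %-≈ : ∀ x → x % p ≈ x
    %-≈ x = modulo (x / p) 0 (trans (sym (m≡m%n+[m/n]*n x p)) (sym (+-identityʳ x)))

    ≈⇒%≡ : ∀ {x y} → x ≈ y → x % p ≡ y % p
    ≈⇒%≡ {x} {y} (modulo s t eq) =
      trans (sym ([m+kn]%n≡m%n x s p)) (trans (cong (_% p) eq) ([m+kn]%n≡m%n y t p))

    _≈?_ : ∀ x y → Dec (x ≈ y)
    x ≈? y with x % p ≟ y % p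
    ... | yes eq = yes (≈-trans (≈-sym (%-≈ x)) (≈-trans (≈-reflexive eq) (%-≈ y)))
    ... | no neq = no λ x≈y → neq (≈⇒%≡ x≈y)

    -- Multiplication by p - 1 represents negation modulo p.
    neg : ℕ → ℕ
    neg x = x * pred p

    neg-inverse : ∀ x → x + neg x ≈ 0
    neg-inverse x = modulo 0 x (begin
      x + x * pred p + 0  ≡⟨ +-identityʳ _ ⟩
      x + x * pred p      ≡⟨ sym (*-suc x (pred p)) ⟩
      x * suc (pred p)    ≡⟨ cong (x *_) (suc-pred p) ⟩
      x * p               ∎)
      where open ≡-Reasoning

complement : ∀ {j e} → j ≤ e → ∃ λ j′ → j + j′ ≡ e
complement {j} {e} j≤e = e ∸ j , m+[n∸m]≡n j≤e

-- Regular graphs from neighbour functions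

≡true-ext : ∀ {a b} → (a ≡ true → b ≡ true) → (b ≡ true → a ≡ true) → a ≡ b
≡true-ext {true}  {b}     f g = sym (f refl)
≡true-ext {false} {true}  f g = g refl
≡true-ext {false} {false} f g = refl

module FromNeighbours {N d : ℕ} (nb : Fin N → Fin d → Fin N)
  (nb-injective : ∀ u → Injective _≡_ _≡_ (nb u))
  (nb-symmetric : ∀ u k → ∃ λ l → nb (nb u k) l ≡ u)
  (nb-irreflexive : ∀ u k → nb u k ≢ u) where

  abstract
    adjacent : Fin N → Fin N → Bool
    adjacent u v = ⌊ any? (λ k → nb u k Fin.≟ v) ⌋

    adjacent⁻ : ∀ {u v} → adjacent u v ≡ true → ∃ λ k → nb u k ≡ v
    adjacent⁻ = toWitness ∘ Equivalence.from T-≡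

    adjacent⁺ : ∀ {u v} → (∃ λ k → nb u k ≡ v) → adjacent u v ≡ true
    adjacent⁺ = Equivalence.to T-≡ ∘ fromWitness

  private
    adjacent-sym : ∀ u v → adjacent u v ≡ true → adjacent v u ≡ true
    adjacent-sym u v uv with adjacent⁻ {u} {v} uv
    ... | k , refl = adjacent⁺ (nb-symmetric u k)

  graph : Graph
  graph = record
    { n = N
    ; adj = adjacent
    ; sym = λ u v → ≡true-ext (adjacent-sym u v) (adjacent-sym v u)
    ; loopless = λ u → ¬-not λ uu → nb-irreflexive u _ (proj₂ (adjacent⁻ {u} {u} uu))
    }

  -- The filtered list and the list of values of `nb u` are both free of duplicates and have the
  -- same members, so they are permutations of each other and equally long.
  regular : Regular d graph
  regular u = trans (↭-length (∼bag⇒↭ (unique∧set⇒bag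
      (filter⁺ (T? ∘ adjacent u) (allFin⁺ N))
      (tabulate⁺ (nb-injective u))
      (mk⇔ to from))))
    (length-tabulate (nb u))
    where
    to : ∀ {v} → v ∈ filterᵇ (adjacent u) (allFin N) → v ∈ tabulate (nb u)
    to {v} v∈ with adjacent⁻ {u} {v} (Equivalence.to T-≡ (proj₂ (∈-filter⁻
        (T? ∘ adjacent u) {xs = allFin N} v∈)))
    ... | k , refl = ∈-tabulate⁺ k
    from : ∀ {v} → v ∈ tabulate (nb u) → v ∈ filterᵇ (adjacent u) (allFin N)
    from v∈ with ∈-tabulate⁻ v∈
    ... | k , refl = ∈-filter⁺ (T? ∘ adjacent u) (∈-allFin _) (Equivalence.from T-≡ (adjacent⁺ (k , refl)))

-- Permutations of the sheets

record Sheets : Set where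
  field
    size : ℕ
    σ σ⁻ : Bool → Fin size → Fin size
    σσ⁻  : ∀ i c → σ i (σ⁻ i c) ≡ c
    σ⁻σ  : ∀ i c → σ⁻ i (σ i c) ≡ c

-- How an edge labelled i between two sheets can be mapped if these sheets go to the sheets d and d′, their
-- chords being reversed according to o and o′ and exchanged according to s and s′.
data Step {N : ℕ} (σ : Bool → Fin N → Fin N) : (o o′ s s′ i : Bool) → Fin N → Fin N → Set where
  forward  : ∀ {s s′ i d d′} → s ≡ s′ → d′ ≡ σ (s xor i) d → Step σ false false s s′ i d d′
  backward : ∀ {s s′ i d d′} → s ≡ s′ → d ≡ σ (s xor i) d′ → Step σ true true s s′ i d d′
  fold     : ∀ {o s s′ i d d′} → s ≢ s′ → d′ ≡ d → Step σ o o s s′ i d d′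

-- The recursion lets `next` compute on numerals even when the size is open; the absurd patterns and
-- the numeral computations below rely on this.
next prev : ∀ {m} → Fin (suc m) → Fin (suc m)
next {zero}  zero    = zero
next {suc m} zero    = suc zero
next {suc m} (suc x) = lift (next x)
  where
  lift : Fin (suc m) → Fin (suc (suc m))
  lift zero    = zero
  lift (suc y) = suc (suc y)
prev {m} zero    = fromℕ m
prev (suc x) = inject₁ x

next-fromℕ : ∀ m → next (fromℕ m) ≡ zero
next-fromℕ zero = refl
next-fromℕ (suc m) rewrite next-fromℕ m = refl

next-inject₁ : ∀ {m} (x : Fin m) → next (inject₁ x) ≡ suc x
next-inject₁ {suc m} zero = refl
next-inject₁ {suc m} (suc x) rewrite next-inject₁ x = refl

next-prev : ∀ {m} (x : Fin (suc m)) → next (prev x) ≡ x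
next-prev {m} zero = next-fromℕ m
next-prev (suc x) = next-inject₁ x

prev-next : ∀ {m} (x : Fin (suc m)) → prev (next x) ≡ x
prev-next x with view x
prev-next {m} _ | ‵fromℕ = cong prev (next-fromℕ m)
... | ‵inject₁ y = cong prev (next-inject₁ y)

toℕ-next : ∀ {m} (x : Fin (suc m)) → toℕ x < m → toℕ (next x) ≡ suc (toℕ x)
toℕ-next x x<m with view x
toℕ-next {m} _ x<m | ‵fromℕ = ⊥-elim (<-irrefl (toℕ-fromℕ m) x<m)
... | ‵inject₁ y = trans (cong toℕ (next-inject₁ y)) (cong suc (sym (toℕ-inject₁ y)))

next-last : ∀ {m} (x : Fin (suc m)) → toℕ x ≡ m → next x ≡ zero
next-last {m} x x≡m = trans (cong next (toℕ-injective (trans x≡m (sym (toℕ-fromℕ m))))) (next-fromℕ m)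

next-invariant : ∀ {m} {A : Set} (h : Fin (suc m) → A) → (∀ x → h (next x) ≡ h x) → ∀ x → h x ≡ h zero
next-invariant h h-next = <-weakInduction (λ x → h x ≡ h zero) refl
  λ x hx → trans (cong h (sym (next-inject₁ x))) (trans (h-next (inject₁ x)) hx)

module _ {m : ℕ} where
  open Congruence (suc m)

  next-≈ : (x : Fin (suc m)) → toℕ (next x) ≈ toℕ x + 1
  next-≈ x with m≤n⇒m<n∨m≡n (s≤s⁻¹ (toℕ<n x))
  ... | inj₁ x<m = ≈-reflexive (trans (toℕ-next x x<m) (+-comm 1 (toℕ x)))
  ... | inj₂ x≡m = ≈-trans (≈-reflexive (cong toℕ (next-last x x≡m))) (lemma x≡m)
    where
    lemma : ∀ {y} → y ≡ m → 0 ≈ y + 1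
    lemma refl = modulo 1 0 (linear-≡ (refl {x = 0}) (solve (m ∷ [])))

  next²-≈ : (x : Fin (suc m)) → toℕ (next (next x)) ≈ toℕ x + 2
  next²-≈ x = lemma (next-≈ (next x)) (next-≈ x)
    where
    -- Here and below, a local lemma replaces compound terms by variables for the ring solver.
    lemma : ∀ {a b c} → c ≈ b + 1 → b ≈ a + 1 → c ≈ a + 2
    lemma {a} {b} {c} h₁ h₂ = linear-≈ (h₁ ⊞ h₂) (solve (c ∷ a ∷ b ∷ []))

  next³-≈ : (x : Fin (suc m)) → toℕ (next (next (next x))) ≈ toℕ x + 3
  next³-≈ x = lemma (next²-≈ (next x)) (next-≈ x)
    where
    lemma : ∀ {a b c} → c ≈ b + 2 → b ≈ a + 1 → c ≈ a + 3
    lemma {a} {b} {c} h₁ h₂ = linear-≈ (h₁ ⊞ h₂) (solve (c ∷ a ∷ b ∷ []))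

  moved : ∀ {x y : Fin (suc m)} k → 1 ≤ k → k ≤ m → toℕ y ≈ toℕ x + k → y ≢ x
  moved k 1≤k k≤m h refl = <-irrefl (sym (≈⇒≡ (lemma h) (≤-trans (s≤s k≤m) (m≤n+m (suc m) 0)) (m≤n⇒m≤o+n k
      (s≤s z≤n)))) 1≤k
    where
    lemma : ∀ {a} → a ≈ a + k → k ≈ 0
    lemma {a} h = linear-≈ (≈-sym h) (solve (k ∷ a ∷ []))

-- The three moved points are pairwise non-adjacent on the long cycle, so that all its edges lie in
-- triangles x, x + 1, x + 2, and their gaps 4, 3, … are unequal, which excludes reversals.
τ τ⁻ : ∀ {m} → Fin (8 + m) → Fin (8 + m)
τ 0F = 7F
τ 4F = 0F
τ 7F = 4F
τ x  = x
τ⁻ 7F = 0F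
τ⁻ 0F = 4F
τ⁻ 4F = 7F
τ⁻ x  = x

pattern 8+ x = suc (suc (suc (suc (suc (suc (suc (suc x)))))))

τ⁻τ : ∀ {m} (x : Fin (8 + m)) → τ⁻ (τ x) ≡ x
τ⁻τ 0F = refl
τ⁻τ 1F = refl
τ⁻τ 2F = refl
τ⁻τ 3F = refl
τ⁻τ 4F = refl
τ⁻τ 5F = refl
τ⁻τ 6F = refl
τ⁻τ 7F = refl
τ⁻τ (8+ x) = refl

ττ⁻ : ∀ {m} (x : Fin (8 + m)) → τ (τ⁻ x) ≡ x
ττ⁻ 0F = refl
ττ⁻ 1F = refl
ττ⁻ 2F = refl
ττ⁻ 3F = refl
ττ⁻ 4F = refl
ττ⁻ 5F = refl
ττ⁻ 6F = refl
ττ⁻ 7F = refl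
ττ⁻ (8+ x) = refl

τ-large : ∀ {m} (x : Fin (8 + m)) → 8 ≤ toℕ x → τ x ≡ x
τ-large (8+ x) _ = refl
τ-large 0F ()
τ-large 1F (s≤s ())
τ-large 2F (s≤s (s≤s ()))
τ-large 3F (s≤s (s≤s (s≤s ())))
τ-large 4F (s≤s (s≤s (s≤s (s≤s ()))))
τ-large 5F (s≤s (s≤s (s≤s (s≤s (s≤s ())))))
τ-large 6F (s≤s (s≤s (s≤s (s≤s (s≤s (s≤s ()))))))
τ-large 7F (s≤s (s≤s (s≤s (s≤s (s≤s (s≤s (s≤s ())))))))

module _ {m : ℕ} where

  private
    no-2-cycle : (x : Fin (14 + m)) → next (next x) ≢ x
    no-2-cycle x = moved 2 (s≤s z≤n) (s≤s (s≤s z≤n)) (next²-≈ x)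

    no-3-cycle : (x : Fin (14 + m)) → next (next (next x)) ≢ x
    no-3-cycle x = moved 3 (s≤s z≤n) (s≤s (s≤s (s≤s z≤n))) (next³-≈ x)

  -- The second permutation is the shift by two, except that 0, 4 and 7 go to 9, 2 and 6. With at
  -- least 14 sheets the numerals met below, up to 13, do not wrap around.
  perm perm⁻ : Bool → Fin (14 + m) → Fin (14 + m)
  perm false x = next x
  perm true  x = next (next (τ x))
  perm⁻ false x = prev x
  perm⁻ true  x = τ⁻ (prev (prev x))

  perm-perm⁻ : ∀ i c → perm i (perm⁻ i c) ≡ c
  perm-perm⁻ false c = next-prev c
  perm-perm⁻ true  c = trans (cong (next ∘ next) (ττ⁻ (prev (prev c)))) (trans (cong next (next-prev (prev c)))
      (next-prev c))

  perm⁻-perm : ∀ i c → perm⁻ i (perm i c) ≡ c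
  perm⁻-perm false c = prev-next c
  perm⁻-perm true  c = trans (cong (τ⁻ ∘ prev) (prev-next (next (τ c)))) (trans (cong τ⁻ (prev-next (τ c)))
      (τ⁻τ c))

  perm-moves : ∀ i c → perm i c ≢ c
  perm-moves false c = moved 1 ≤-refl (s≤s z≤n) (next-≈ c)
  perm-moves true 0F ()
  perm-moves true 1F = no-2-cycle 1F
  perm-moves true 2F = no-2-cycle 2F
  perm-moves true 3F = no-2-cycle 3F
  perm-moves true 4F ()
  perm-moves true 5F = no-2-cycle 5F
  perm-moves true 6F = no-2-cycle 6F
  perm-moves true 7F ()
  perm-moves true (8+ x) = no-2-cycle (8+ x)

  -- The composite is the shift by three except that 0, 4 and 7 go to 10, 3 and 7. Its only fixed
  -- point serves as an anchor for both aligned and reversed sheet maps.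
  next-perm-fixed : ∀ c → next (perm true c) ≡ c → c ≡ 7F
  next-perm-fixed 7F _ = refl
  next-perm-fixed 0F ()
  next-perm-fixed 4F ()
  next-perm-fixed 1F h = ⊥-elim (no-3-cycle 1F h)
  next-perm-fixed 2F h = ⊥-elim (no-3-cycle 2F h)
  next-perm-fixed 3F h = ⊥-elim (no-3-cycle 3F h)
  next-perm-fixed 5F h = ⊥-elim (no-3-cycle 5F h)
  next-perm-fixed 6F h = ⊥-elim (no-3-cycle 6F h)
  next-perm-fixed (8+ x) h = ⊥-elim (no-3-cycle (8+ x) h)

sheets : ℕ → Sheets
sheets m = record { size = 14 + m ; σ = perm ; σ⁻ = perm⁻ ; σσ⁻ = perm-perm⁻ ; σ⁻σ = perm⁻-perm }

-- Maps between sheets compatible with the permutations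

module SheetMap {a b : ℕ} (o s : Fin (14 + a) → Bool) (h : Fin (14 + a) → Fin (14 + b))
  (steps : ∀ c i → Step perm (o c) (o (perm i c)) (s c) (s (perm i c)) i (h c) (h (perm i c))) where

  private
    Step-o : ∀ {o o′ s s′ i} {d d′ : Fin (14 + b)} → Step perm o o′ s s′ i d d′ → o′ ≡ o
    Step-o (forward _ _)  = refl
    Step-o (backward _ _) = refl
    Step-o (fold _ _)     = refl

    Step-fold : ∀ {o o′ s s′ i} {d d′ : Fin (14 + b)} → s ≢ s′ → Step perm o o′ s s′ i d d′ → d′ ≡ d
    Step-fold s≢s′ (forward s≡s′ _)  = ⊥-elim (s≢s′ s≡s′)
    Step-fold s≢s′ (backward s≡s′ _) = ⊥-elim (s≢s′ s≡s′)
    Step-fold s≢s′ (fold _ d′≡d)     = d′≡d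

    Step-moves : ∀ {o o′ s i} {d d′ : Fin (14 + b)} → Step perm o o′ s s i d d′ → d′ ≢ d
    Step-moves {s = s} {i} {d} (forward _ refl)       = perm-moves (s xor i) d
    Step-moves {s = s} {i} {d′ = d′} (backward _ refl) = perm-moves (s xor i) d′ ∘ sym
    Step-moves (fold s≢s _)           = ⊥-elim (s≢s refl)

    -- Two of three Booleans agree, so either none or exactly two of the sides of a triangle are folded;
    -- in the latter case the ends of the third side would coincide.
    triangle : ∀ {o₁ o₂ o₃ i j k} s₁ s₂ s₃ {d₁ d₂ d₃ : Fin (14 + b)} →
      Step perm o₁ o₂ s₁ s₂ i d₁ d₂ → Step perm o₂ o₃ s₂ s₃ j d₂ d₃ → Step perm o₁ o₃ s₁ s₃ k d₁ d₃ →
      s₂ ≡ s₁ × s₃ ≡ s₂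
    triangle false false false _ _ _ = refl , refl
    triangle true  true  true  _ _ _ = refl , refl
    triangle false false true  A B C = ⊥-elim (Step-moves A (trans (sym (Step-fold (λ ()) B)) (Step-fold (λ
        ()) C)))
    triangle true  true  false A B C = ⊥-elim (Step-moves A (trans (sym (Step-fold (λ ()) B)) (Step-fold (λ
        ()) C)))
    triangle false true  true  A B C = ⊥-elim (Step-moves B (trans (Step-fold (λ ()) C) (sym (Step-fold (λ
        ()) A))))
    triangle true  false false A B C = ⊥-elim (Step-moves B (trans (Step-fold (λ ()) C) (sym (Step-fold (λ
        ()) A))))
    triangle false true  false A B C = ⊥-elim (Step-moves C (trans (Step-fold (λ ()) B) (Step-fold (λ ()) A)))
    triangle true  false true  A B C = ⊥-elim (Step-moves C (trans (Step-fold (λ ()) B) (Step-fold (λ ()) A)))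

    unmarked-triangle : ∀ c → τ c ≡ c → s (next c) ≡ s c × s (next (next c)) ≡ s (next c)
    unmarked-triangle c τc≡c = triangle _ _ _ (steps c false) (steps (next c) false)
      (subst (λ x → Step perm (o c) (o (next (next x))) (s c) (s (next (next x))) true (h c) (h (next
          (next x)))) τc≡c (steps c true))

    s-next : ∀ c → s (next c) ≡ s c
    -- The points 0, 4 and 7 are moved by `τ`, so the triangle that starts at their predecessor is
    -- used instead.
    s-next 0F = subst (λ c → s (next c) ≡ s c) (next-prev 0F) (proj₂ (unmarked-triangle (prev 0F) refl))
    s-next 1F = proj₁ (unmarked-triangle 1F refl)
    s-next 2F = proj₁ (unmarked-triangle 2F refl)
    s-next 3F = proj₁ (unmarked-triangle 3F refl)
    s-next 4F = proj₂ (unmarked-triangle 3F refl)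
    s-next 5F = proj₁ (unmarked-triangle 5F refl)
    s-next 6F = proj₁ (unmarked-triangle 6F refl)
    s-next 7F = proj₂ (unmarked-triangle 6F refl)
    s-next (8+ x) = proj₁ (unmarked-triangle (8+ x) refl)

    s-constant : ∀ c → s c ≡ s 0F
    s-constant = next-invariant s s-next

    o-constant : ∀ c → o c ≡ o 0F
    o-constant = next-invariant o (λ c → Step-o (steps c false))

    uniform-step : ∀ c i → Step perm (o 0F) (o 0F) (s 0F) (s 0F) i (h c) (h (perm i c))
    uniform-step c i = lemma (o-constant c) (o-constant (perm i c)) (s-constant c) (s-constant (perm i c))
        (steps c i)
      where
      lemma : ∀ {o₁ o₂ s₁ s₂ i} {d d′ : Fin (14 + b)} → o₁ ≡ o 0F → o₂ ≡ o 0F → s₁ ≡ s 0F → s₂ ≡ s 0F →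
        Step perm o₁ o₂ s₁ s₂ i d d′ → Step perm (o 0F) (o 0F) (s 0F) (s 0F) i d d′
      lemma refl refl refl refl step = step

    Uniform : Bool → Bool → Set
    Uniform o s = ∀ c i → Step (perm {b}) o o s s i (h c) (h (perm i c))

    to : ∀ {s} → Uniform false s → ∀ c i → h (perm i c) ≡ perm (s xor i) (h c)
    to steps c i with steps c i
    ... | forward _ eq = eq
    ... | fold s≢s _ = ⊥-elim (s≢s refl)

    from : ∀ {s} → Uniform true s → ∀ c i → h c ≡ perm (s xor i) (h (perm i c))
    from steps c i with steps c i
    ... | backward _ eq = eq
    ... | fold s≢s _ = ⊥-elim (s≢s refl)

    -- 2 → 4 → 2 under the second permutation, but the square of the first one moves every point.
    not-swapped : ∀ o → ¬ Uniform o true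
    not-swapped false st = moved 2 (s≤s z≤n) (s≤s (s≤s z≤n)) (next²-≈ (h 2F))
      (sym (trans (to st 4F true) (cong next (to st 2F true))))
    not-swapped true st = moved 2 (s≤s z≤n) (s≤s (s≤s z≤n)) (next²-≈ (h 2F))
      (sym (trans (from st 2F true) (cong next (from st 4F true))))

    -- Following the relations backwards from h 6 = 7 gives h 4 = 9 and h 2 = 11, but 11 is sent to 13 rather than 9.
    not-reversed : ¬ Uniform true false
    not-reversed st = absurd (trans (sym h4) (trans (from st 4F true) (cong (perm true) h2)))
      where
      h6 : h 6F ≡ 7F
      h6 = next-perm-fixed (h 6F) (sym (trans (from st 6F false) (cong next (from st 7F true))))
      h5 : h 5F ≡ 8F
      h5 = trans (from st 5F false) (cong next h6)
      h4 : h 4F ≡ 9F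
      h4 = trans (from st 4F false) (cong next h5)
      h3 : h 3F ≡ suc 9F
      h3 = trans (from st 3F false) (cong next h4)
      h2 : h 2F ≡ suc (suc 9F)
      h2 = trans (from st 2F false) (cong next h3)
      absurd : ¬ (Fin (14 + b) ∋ 9F) ≡ suc (suc (suc (suc 9F)))
      absurd ()

    module Aligned (st : Uniform false false) where

      h7 : h 7F ≡ 7F
      h7 = next-perm-fixed (h 7F) (sym (trans (to st 6F false) (cong next (to st 7F true))))

      h-suc : ∀ y → h (suc y) ≡ next (h (inject₁ y))
      h-suc y = trans (cong h (sym (next-inject₁ y))) (to st (inject₁ y) false)

      -- Starting from the anchor 7, the first permutation advances argument and image together
      -- until the target cycle ends.
      toℕ-h : ∀ x → 7 ≤ toℕ x → toℕ x < 14 + b → toℕ (h x) ≡ toℕ x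
      toℕ-h = <-weakInduction (λ x → 7 ≤ toℕ x → toℕ x < 14 + b → toℕ (h x) ≡ toℕ x) (λ ()) go
        where
        go : ∀ y → (7 ≤ toℕ (inject₁ y) → toℕ (inject₁ y) < 14 + b → toℕ (h (inject₁ y)) ≡ toℕ (inject₁ y)) →
          7 ≤ toℕ (suc y) → toℕ (suc y) < 14 + b → toℕ (h (suc y)) ≡ toℕ (suc y)
        go y ih 7≤ <m with m≤n⇒m<n∨m≡n 7≤
        ... | inj₂ 7≡ = trans (cong (toℕ ∘ h) (sym (toℕ-injective {i = 7F} 7≡))) (trans (cong toℕ h7) 7≡)
        ... | inj₁ 7< = trans (cong toℕ (h-suc y)) (trans (toℕ-next (h (inject₁ y)) (subst (_< 13 + b) (sym hy)
            (s≤s⁻¹ <m))) (cong suc hy))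
          where
          hy : toℕ (h (inject₁ y)) ≡ toℕ y
          hy = trans (ih (subst (7 ≤_) (sym (toℕ-inject₁ y)) (s≤s⁻¹ 7<)) (subst (_< 14 + b) (sym
              (toℕ-inject₁ y)) (<⇒≤ <m))) (toℕ-inject₁ y)

      -- The source cycle would close while the target continues, so 0 would go to 14 + a. The
      -- second permutation takes 0 to 9, whose image is 9, but takes 14 + a two places further;
      -- these do not agree modulo 14 + b.
      a≮b : ¬ a < b
      a≮b a<b = lemma (≈-trans (≈-reflexive (sym h9)) (≈-trans (≈-reflexive (cong toℕ eq)) (next²-≈ (h 0F))))
        where
        open Congruence (14 + b)
        last : Fin (14 + a)
        last = fromℕ (13 + a)
        h-last : toℕ (h last) ≡ 13 + a
        h-last = trans (toℕ-h last (subst (7 ≤_) (sym (toℕ-fromℕ (13 + a))) (m≤m+n 7 (6 + a)))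
          (subst (_< 14 + b) (sym (toℕ-fromℕ (13 + a))) (+-monoʳ-≤ 14 (<⇒≤ a<b)))) (toℕ-fromℕ (13 + a))
        h0 : toℕ (h 0F) ≡ 14 + a
        h0 = trans (cong toℕ (trans (cong h (sym (next-fromℕ (13 + a)))) (to st last false)))
          (trans (toℕ-next (h last) (subst (_< 13 + b) (sym h-last) (+-monoʳ-< 13 a<b))) (cong suc h-last))
        h9 : toℕ (h 9F) ≡ 9
        h9 = toℕ-h 9F (m≤m+n 7 2) (m≤m+n 10 (4 + b))
        eq : h 9F ≡ next (next (h 0F))
        eq = trans (to st 0F true) (cong (next ∘ next) (τ-large (h 0F) (subst (8 ≤_) (sym h0) (m≤m+n 8
            (6 + a)))))
        lemma : ¬ 9 ≈ toℕ (h 0F) + 2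
        lemma rewrite h0 = λ h → bound (≈⇒≡ h (linear-≤ (z≤n {0}) (20 + a + b)
            (solve (a ∷ b ∷ []))) (linear-≤ a<b 7 (solve (a ∷ b ∷ []))))
          where
          bound : ¬ 9 ≡ 14 + a + 2
          bound h = linear-⊥ (≤-reflexive (sym h)) (6 + a) (solve (a ∷ []))

      -- The target cycle would close first, so that y = 14 + b goes to 0. At y the second
      -- permutation is two steps of the first, which lead from the image 0 to 2, whereas the second
      -- permutation takes 0 to 9.
      b≮a : ¬ b < a
      b≮a b<a = absurd (trans (sym (cong (perm true) hy)) (trans (sym (to st y true)) (trans (cong
          (h ∘ next ∘ next) (τ-large y (subst (8 ≤_) (sym toℕ-y) (m≤m+n 8 (6 + b)))))
            (trans (to st (next y) false) (trans (cong next (to st y false)) (cong (next ∘ next) hy))))))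
        where
        x<14+a : 13 + b < 14 + a
        x<14+a = +-monoʳ-≤ 14 (<⇒≤ b<a)
        x y : Fin (14 + a)
        x = fromℕ< x<14+a
        y = next x
        toℕ-x : toℕ x ≡ 13 + b
        toℕ-x = toℕ-fromℕ< x<14+a
        toℕ-y : toℕ y ≡ 14 + b
        toℕ-y = trans (toℕ-next x (subst (_< 13 + a) (sym toℕ-x) (+-monoʳ-< 13 b<a))) (cong suc toℕ-x)
        hy : h y ≡ 0F
        hy = trans (to st x false) (next-last (h x) (trans (toℕ-h x (subst (7 ≤_) (sym toℕ-x) (m≤m+n 7 (6 + b)))
          (subst (_< 14 + b) (sym toℕ-x) ≤-refl)) toℕ-x))
        absurd : ¬ (Fin (14 + b) ∋ 9F) ≡ 2F
        absurd ()

      a≡b : a ≡ b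
      a≡b with <-cmp a b
      ... | tri< a<b _ _ = ⊥-elim (a≮b a<b)
      ... | tri≈ _ eq _ = eq
      ... | tri> _ _ b<a = ⊥-elim (b≮a b<a)

      h0 : h 0F ≡ 0F
      h0 = trans (cong h (sym (next-fromℕ (13 + a)))) (trans (to st last false) (next-last (h last)
          (trans (toℕ-h last (subst (7 ≤_) (sym (toℕ-fromℕ (13 + a))) (m≤m+n 7 (6 + a)))
            (subst (_< 14 + b) (sym (toℕ-fromℕ (13 + a))) (≤-reflexive (cong (14 +_) a≡b))))
          (trans (toℕ-fromℕ (13 + a)) (cong (13 +_) a≡b)))))
        where
        last : Fin (14 + a)
        last = fromℕ (13 + a)

      toℕ-preserved : ∀ x → toℕ (h x) ≡ toℕ x
      toℕ-preserved = <-weakInduction (λ x → toℕ (h x) ≡ toℕ x) (cong toℕ h0) λ y ih →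
        trans (cong toℕ (h-suc y)) (trans (toℕ-next (h (inject₁ y)) (subst (_< 13 + b) (sym (trans ih
            (toℕ-inject₁ y)))
          (subst (λ k → toℕ y < 13 + k) a≡b (toℕ<n y)))) (cong suc (trans ih (toℕ-inject₁ y))))

    Conclusion : Set
    Conclusion = a ≡ b × (∀ c → o c ≡ false) × (∀ c → s c ≡ false) × (∀ c → toℕ (h c) ≡ toℕ c)

    by-type : ∀ o₀ s₀ → o 0F ≡ o₀ → s 0F ≡ s₀ → Conclusion
    by-type o₀ true o≡ s≡ = ⊥-elim (not-swapped o₀ λ c i → subst₂ (λ o s → Step perm o o s s i (h c) (h
        (perm i c))) o≡ s≡ (uniform-step c i))
    by-type true false o≡ s≡ = ⊥-elim (not-reversed λ c i → subst₂ (λ o s → Step perm o o s s i (h c) (h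
        (perm i c))) o≡ s≡ (uniform-step c i))
    by-type false false o≡ s≡ = a≡b , (λ c → trans (o-constant c) o≡) , (λ c → trans
        (s-constant c) s≡) , toℕ-preserved
      where
      open Aligned (λ c i → subst₂ (λ o s → Step perm o o s s i (h c) (h (perm i c))) o≡ s≡ (uniform-step c i))

  rigid : a ≡ b × (∀ c → o c ≡ false) × (∀ c → s c ≡ false) × (∀ c → toℕ (h c) ≡ toℕ c)
  rigid = by-type (o 0F) (s 0F) refl refl

-- The circular clique and its lifts

-- Here `e₁` is e - 1. The numbers are variables tied by equations, so that the ring solver treats
-- them as atoms.
module Circulant (e₁ e r q p : ℕ) (e≡ : suc e₁ ≡ e) (2≤e : 2 ≤ e) (2≤r : 2 ≤ r)
                 (q≡ : q ≡ r * e + 1) (p≡ : q + q + e ≡ p) .{{_ : NonZero p}} where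

  open Congruence p public

  p≈0 : q + q + e ≈ 0
  p≈0 = modulo 0 1 (trans (+-identityʳ _) (trans p≡ (sym (+-identityʳ p))))

  -- In fact (2r + 1)q = rp + 1. Hence 2r + 1 steps of length q advance by a single vertex, and q is
  -- invertible modulo p.
  kq≈1 : (r + r + 1) * q ≈ 1
  kq≈1 = modulo 0 r (begin
    (r + r + 1) * q + 0          ≡⟨ linear-≡ (refl {x = 0}) (solve (r ∷ q ∷ [])) ⟩
    (r + r) * q + q              ≡⟨ cong ((r + r) * q +_) q≡ ⟩
    (r + r) * q + (r * e + 1)    ≡⟨ linear-≡ (refl {x = 0}) (solve (r ∷ q ∷ e ∷ [])) ⟩
    1 + r * (q + q + e)          ≡⟨ cong (λ z → 1 + r * z) p≡ ⟩
    1 + r * p                    ∎)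
    where open ≡-Reasoning

  -- The assumption that the odd girth is at least 7 enters through this bound, which rules out
  -- wrap-around in the estimates below.
  2e<q : e + e + 1 ≤ q
  2e<q = linear-≤ ((≤-reflexive (sym q≡)) ⊕ ((2 * e ≤ r * e) ∋ *-monoˡ-≤ e 2≤r)) 0 (solve (e ∷ q ∷ r ∷ []))

  -- Adjacency, walks and common neighbours in the circular clique

  record Adj (x y : ℕ) : Set where
    constructor step
    field
      j   : ℕ
      j≤e : j ≤ e
      y≈  : y ≈ x + q + j

  record Reach (l x y : ℕ) : Set where
    constructor reach
    field
      J    : ℕ
      J≤le : J ≤ l * e
      y≈   : y ≈ x + l * q + J

  -- Since p = 2q + e, an offset j becomes e - j when the edge is read backwards.
  Adj-sym : ∀ {x y} → Adj x y → Adj y x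
  Adj-sym {x} {y} (step j j≤e y≈) with complement j≤e
  ... | j′ , j+j′≡e = step j′ (linear-≤ (≤-reflexive j+j′≡e) j (solve (j′ ∷ e ∷ j ∷ [])))
    (linear-≈ ((≈-sym y≈) ⊞ (≈-reflexive (sym j+j′≡e)) ⊞ (≈-sym p≈0)) (solve (x ∷ y ∷ q ∷ j′ ∷ j ∷ e ∷ [])))

  Adj-resp : ∀ {x x′ y y′} → x ≈ x′ → y ≈ y′ → Adj x y → Adj x′ y′
  Adj-resp {x} {x′} {y} {y′} x≈x′ y≈y′ (step j j≤e y≈) = step j j≤e
    (linear-≈ (x≈x′ ⊞ (≈-sym y≈y′) ⊞ y≈) (solve (y′ ∷ x′ ∷ q ∷ j ∷ x ∷ y ∷ [])))

  Adj⇒Reach : ∀ {x y} → Adj x y → Reach 1 x y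
  Adj⇒Reach {x} {y} (step j j≤e y≈) = reach j (linear-≤ j≤e 0 (solve (j ∷ e ∷ []))) (linear-≈ y≈
      (solve (y ∷ x ∷ q ∷ j ∷ [])))

  Reach-refl : ∀ {x y} → x ≈ y → Reach 0 x y
  Reach-refl {x} {y} x≈y = reach 0 z≤n (linear-≈ (≈-sym x≈y) (solve (y ∷ x ∷ q ∷ [])))

  Reach-trans : ∀ {l m x y z} → Reach l x y → Reach m y z → Reach (l + m) x z
  Reach-trans {l} {m} {x} {y} {z} (reach J J≤ y≈) (reach K K≤ z≈) = reach (J + K)
    (linear-≤ (J≤ ⊕ K≤) 0 (solve (J ∷ K ∷ l ∷ m ∷ e ∷ [])))
    (linear-≈ (y≈ ⊞ z≈) (solve (z ∷ x ∷ l ∷ m ∷ q ∷ J ∷ K ∷ y ∷ [])))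

  -- For ℓ = 2m + 1 steps of total length ℓq + J = tp with 0 ≤ J ≤ ℓe, comparing t with m and m + 1
  -- gives q ≤ me in either case, because p = 2q + e.
  odd-closed : ∀ m {x y} → Reach (suc (m + m)) x y → x ≈ y → r < m
  odd-closed m {x} {y} (reach J J≤ y≈) x≈y = r<m (q≤me (linear-≈ ((≈-sym x≈y) ⊞ (≈-sym y≈))
      (solve (m ∷ q ∷ J ∷ x ∷ y ∷ []))))
    where
    -- The modulus is a variable `P` here, so that matching on `refl` can replace it by 2q + e.
    bound : ∀ s t P → q + q + e ≡ P → suc (m + m) * q + J + s * P ≡ 0 + t * P → t * P ≤ (m + s) * P
        ⊎ suc (m + s) * P ≤ t * P → q ≤ m * e
    bound s t _ refl eq (inj₁ h) = linear-≤ ((≤-reflexive eq) ⊕ h) J (solve (q ∷ m ∷ e ∷ J ∷ s ∷ t ∷ []))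
    bound s t _ refl eq (inj₂ h) = linear-≤ ((≤-reflexive (sym eq)) ⊕ h ⊕ J≤) 0
        (solve (q ∷ m ∷ e ∷ J ∷ s ∷ t ∷ []))
    q≤me : suc (m + m) * q + J ≈ 0 → q ≤ m * e
    q≤me (modulo s t eq) with ≤-<-connex t (m + s)
    ... | inj₁ t≤ = bound s t p p≡ eq (inj₁ (*-monoˡ-≤ p t≤))
    ... | inj₂ <t = bound s t p p≡ eq (inj₂ (*-monoˡ-≤ p <t))
    r<m : q ≤ m * e → r < m
    r<m q≤me with ≤-<-connex m r
    ... | inj₂ r<m = r<m
    ... | inj₁ m≤r = ⊥-elim (linear-⊥ (q≤me ⊕ (≤-reflexive (sym q≡)) ⊕ ((m * e ≤ r * e) ∋ *-monoˡ-≤ e m≤r)) 0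
        (solve (q ∷ m ∷ e ∷ r ∷ [])))

  -- The neighbourhoods x + q, ..., x + q + e and x + e + q, ..., x + 2e + q share only x + e + q; p
  -- is too large for them to meet again on the other side.
  pinch : ∀ {x z} → Adj x z → Adj (x + e) z → z ≈ x + e + q
  pinch {x} {z} (step a a≤e z≈) (step b b≤e z≈′) = linear-≈ (z≈ ⊞ (≈-reflexive a≡e))
      (solve (z ∷ x ∷ e ∷ q ∷ a ∷ []))
    where
    a≡e+b : a ≡ e + b
    a≡e+b = ≈⇒≡ (linear-≈ ((≈-sym z≈) ⊞ z≈′) (solve (a ∷ e ∷ b ∷ z ∷ x ∷ q ∷ [])))
      (linear-≤ (a≤e ⊕ (≤-reflexive p≡) ⊕ 2e<q) (b + 3 * e + q) (solve (a ∷ e ∷ b ∷ p ∷ q ∷ [])))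
      (linear-≤ (b≤e ⊕ (≤-reflexive p≡) ⊕ 2e<q) (a + e + q) (solve (e ∷ b ∷ a ∷ p ∷ q ∷ [])))
    a≡e : a ≡ e
    a≡e = ≤-antisym a≤e (linear-≤ (≤-reflexive (sym a≡e+b)) b (solve (e ∷ a ∷ b ∷ [])))

  -- Two vertices at circular distance t have only e + 1 - t common neighbours.
  module _ (u v : ℕ) (w : Fin e → ℕ) (w-injective : ∀ {i j} → w i ≈ w j → i ≡ j)
           (u~w : ∀ i → Adj u (w i)) (v~w : ∀ i → Adj v (w i)) where

    private
      a b : Fin e → ℕ
      a i = Adj.j (u~w i)
      b i = Adj.j (v~w i)

    -- Modulo p the difference `a i` - `b i` is always v - u, and offsets of at most e are too small
    -- for it to wrap around.
    constant-offset : ∀ i j → a i + b j ≡ b i + a j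
    constant-offset i j = lemma (Adj.y≈ (u~w i)) (Adj.y≈ (v~w i)) (Adj.y≈ (u~w j)) (Adj.y≈ (v~w j))
      (Adj.j≤e (u~w i)) (Adj.j≤e (v~w i)) (Adj.j≤e (u~w j)) (Adj.j≤e (v~w j))
      where
      lemma : ∀ {x y a b a′ b′} → x ≈ u + q + a → x ≈ v + q + b → y ≈ u + q + a′ → y ≈ v + q + b′ →
        a ≤ e → b ≤ e → a′ ≤ e → b′ ≤ e → a + b′ ≡ b + a′
      lemma {x} {y} {a} {b} {a′} {b′} h₁ h₂ h₃ h₄ a≤ b≤ a′≤ b′≤ = ≈⇒≡
        (linear-≈ ((≈-sym h₁) ⊞ h₂ ⊞ h₃ ⊞ (≈-sym h₄)) (solve (a ∷ b′ ∷ b ∷ a′ ∷ x ∷ u ∷ q ∷ v ∷ y ∷ [])))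
        (linear-≤ (a≤ ⊕ b′≤ ⊕ (≤-reflexive p≡) ⊕ 2e<q) (a′ + b + e + q)
            (solve (a ∷ b′ ∷ b ∷ a′ ∷ p ∷ e ∷ q ∷ [])))
        (linear-≤ (b≤ ⊕ a′≤ ⊕ (≤-reflexive p≡) ⊕ 2e<q) (a + b′ + e + q)
            (solve (b ∷ a′ ∷ a ∷ b′ ∷ p ∷ e ∷ q ∷ [])))

    -- If `a` exceeds `b` by t everywhere, then all `b j` are at most e - t. They are distinct
    -- because the `w j` are, so e values fit into e - t + 1 places.
    offset≤1 : ∀ i t → a i ≡ b i + t → t ≤ 1
    offset≤1 i t aᵢ≡ with complement (lemma aᵢ≡ (Adj.j≤e (u~w i)))
      where
      lemma : ∀ {a b} → a ≡ b + t → a ≤ e → t ≤ e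
      lemma {a} {b} h a≤ = linear-≤ ((≤-reflexive (sym h)) ⊕ a≤) b (solve (t ∷ e ∷ a ∷ b ∷ []))
    ... | s , t+s≡e = linear-≤ (h ⊕ (≤-reflexive t+s≡e)) 0 (solve (t ∷ e ∷ s ∷ []))
      where
      b≤s : ∀ j → b j < suc s
      b≤s j = s≤s (lemma aᵢ≡ (constant-offset i j) (Adj.j≤e (u~w j)))
        where
        lemma : ∀ {aᵢ bᵢ aⱼ bⱼ} → aᵢ ≡ bᵢ + t → aᵢ + bⱼ ≡ bᵢ + aⱼ → aⱼ ≤ e → bⱼ ≤ s
        lemma {aᵢ} {bᵢ} {aⱼ} {bⱼ} h₁ h₂ h₃ = linear-≤ ((≤-reflexive (sym h₁)) ⊕ (≤-reflexive h₂) ⊕ h₃ ⊕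
            (≤-reflexive (sym t+s≡e))) 0 (solve (bⱼ ∷ s ∷ aᵢ ∷ bᵢ ∷ t ∷ aⱼ ∷ e ∷ []))
      h : e ≤ suc s
      h = injective⇒≤ {f = λ j → fromℕ< (b≤s j)} λ {j} {k} eq → w-injective (lemma
        (trans (sym (toℕ-fromℕ< (b≤s j))) (trans (cong toℕ eq) (toℕ-fromℕ< (b≤s k))))
        (Adj.y≈ (v~w j)) (Adj.y≈ (v~w k)))
        where
        lemma : ∀ {x y b b′} → b ≡ b′ → x ≈ v + q + b → y ≈ v + q + b′ → x ≈ y
        lemma {x} {y} {b} refl h₁ h₂ = linear-≈ (h₁ ⊞ (≈-sym h₂)) (solve (x ∷ y ∷ v ∷ q ∷ b ∷ []))

  common-neighbours : ∀ u v (w : Fin e → ℕ) → (∀ {i j} → w i ≈ w j → i ≡ j) →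
    (∀ i → Adj u (w i)) → (∀ i → Adj v (w i)) → u ≈ v ⊎ v ≈ u + 1 ⊎ u ≈ v + 1
  common-neighbours u v w w-injective u~w v~w = by-offset (fromℕ< (≤-trans (s≤s z≤n) 2≤e))
    where
    by-difference : ∀ u v a b t {w} → w ≈ u + q + a → w ≈ v + q + b → b + t ≡ a → t ≤ 1 → u ≈ v ⊎ v ≈ u + 1
    by-difference u v a b .0 {w} h₁ h₂ h₃ z≤n = inj₁ (linear-≈ ((≈-sym h₁) ⊞ h₂ ⊞ (≈-reflexive h₃))
        (solve (u ∷ v ∷ w ∷ q ∷ a ∷ b ∷ [])))
    by-difference u v a b .1 {w} h₁ h₂ h₃ (s≤s z≤n) = inj₂ (linear-≈ (h₁ ⊞ (≈-sym h₂) ⊞ (≈-reflexive (sym h₃)))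
        (solve (v ∷ u ∷ w ∷ q ∷ a ∷ b ∷ [])))
    by-offset : Fin e → u ≈ v ⊎ v ≈ u + 1 ⊎ u ≈ v + 1
    by-offset i = [ from-above , from-below ]′ (≤-total (Adj.j (v~w i)) (Adj.j (u~w i)))
      where
      from-above : Adj.j (v~w i) ≤ Adj.j (u~w i) → u ≈ v ⊎ v ≈ u + 1 ⊎ u ≈ v + 1
      from-above b≤a = map₂ inj₁ (by-difference u v _ _ t (Adj.y≈ (u~w i)) (Adj.y≈ (v~w i)) b+t≡a
        (offset≤1 u v w w-injective u~w v~w i t (sym b+t≡a)))
        where
        t = proj₁ (complement b≤a)
        b+t≡a = proj₂ (complement b≤a)
      from-below : Adj.j (u~w i) ≤ Adj.j (v~w i) → u ≈ v ⊎ v ≈ u + 1 ⊎ u ≈ v + 1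
      from-below a≤b = [ inj₁ ∘ ≈-sym , inj₂ ∘ inj₂ ]′ (by-difference v u _ _ t (Adj.y≈ (v~w i))
          (Adj.y≈ (u~w i)) a+t≡b
        (offset≤1 v u w w-injective v~w u~w i t (sym a+t≡b)))
        where
        t = proj₁ (complement a≤b)
        a+t≡b = proj₂ (complement a≤b)

  -- The ends of the two chords

  -- The ends 0, 1, q + e - 1 and q + e of the two chords along which the sheets of the lift are permuted.
  data Blocked (x : ℕ) : Set where
    low  : ∀ b → x ≈ b → b ≤ 1 → Blocked x
    high : ∀ b → x ≈ b → q + e ≤ b + 1 → b ≤ q + e → Blocked x

  Blocked-resp : ∀ {x y} → x ≈ y → Blocked x → Blocked y
  Blocked-resp x≈y (low b x≈b b≤1) = low b (≈-trans (≈-sym x≈y) x≈b) b≤1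
  Blocked-resp x≈y (high b x≈b ≤b b≤) = high b (≈-trans (≈-sym x≈y) x≈b) ≤b b≤

  blocked? : ∀ x → Dec (Blocked x)
  blocked? x with x ≈? 0 | x ≈? 1 | (x + 1) ≈? (q + e) | x ≈? (q + e)
  ... | yes x≈ | _ | _ | _ = yes (low 0 x≈ z≤n)
  ... | no _ | yes x≈ | _ | _ = yes (low 1 x≈ ≤-refl)
  ... | no _ | no _ | yes x≈ | _ = yes (high (q + e ∸ 1) (lemma (m∸n+n≡m 1≤q+e) x≈) (≤-reflexive (sym
      (m∸n+n≡m 1≤q+e))) (m∸n≤m (q + e) 1))
    where
    1≤q+e : 1 ≤ q + e
    1≤q+e = linear-≤ 2≤e (1 + q) (solve (q ∷ e ∷ []))
    lemma : ∀ {b} → b + 1 ≡ q + e → x + 1 ≈ q + e → x ≈ b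
    lemma {b} h₁ h₂ = linear-≈ ((≈-reflexive (sym h₁)) ⊞ h₂) (solve (x ∷ b ∷ q ∷ e ∷ []))
  ... | no _ | no _ | no _ | yes x≈ = yes (high (q + e) x≈ (m≤m+n (q + e) 1) ≤-refl)
  ... | no ¬0 | no ¬1 | no ¬Q | no ¬Q+1 = no refute
    where
    lemma : ∀ {b} → x ≈ b → q + e ≡ b + 1 → x + 1 ≈ q + e
    lemma {b} h₁ h₂ = linear-≈ (h₁ ⊞ (≈-reflexive (sym h₂))) (solve (x ∷ q ∷ e ∷ b ∷ []))
    refute : ¬ Blocked x
    refute (low .0 x≈ z≤n) = ¬0 x≈
    refute (low .1 x≈ (s≤s z≤n)) = ¬1 x≈
    refute (high b x≈ ≤b b≤) = [ (λ b< → ¬Q (lemma x≈ (≤-antisym ≤b (subst (_≤ q + e) (+-comm 1 b) b<)))) ,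
                                 (λ b≡ → ¬Q+1 (≈-trans x≈ (≈-reflexive b≡))) ]′ (m≤n⇒m<n∨m≡n b≤)

  unblocked : ∀ {x} → 2 ≤ x → x + 2 ≤ q + e → ¬ Blocked x
  unblocked {x} 2≤x x+2≤ (low b x≈b b≤1) = linear-⊥ ((≤-reflexive x≡b) ⊕ b≤1 ⊕ 2≤x) 0 (solve (x ∷ b ∷ []))
    where
    x≡b : x ≡ b
    x≡b = ≈⇒≡ x≈b (linear-≤ (x+2≤ ⊕ (≤-reflexive p≡)) (1 + b + q) (solve (x ∷ b ∷ p ∷ q ∷ e ∷ [])))
                  (linear-≤ (b≤1 ⊕ 2≤x) p (solve (b ∷ x ∷ p ∷ [])))
  unblocked {x} 2≤x x+2≤ (high b x≈b ≤b b≤) = linear-⊥ ((≤-reflexive (sym x≡b)) ⊕ ≤b ⊕ x+2≤) 0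
      (solve (x ∷ b ∷ q ∷ e ∷ []))
    where
    x≡b : x ≡ b
    x≡b = ≈⇒≡ x≈b (linear-≤ (x+2≤ ⊕ (≤-reflexive p≡)) (1 + b + q) (solve (x ∷ b ∷ p ∷ q ∷ e ∷ [])))
                  (linear-≤ (b≤ ⊕ 2≤x ⊕ (≤-reflexive p≡)) (1 + q) (solve (b ∷ x ∷ p ∷ q ∷ e ∷ [])))

  -- The pairs {0, 1} and {q + e - 1, q + e} are more than e apart both ways round the circle, and
  -- within a pair the distance is one.
  blocked-gap : ∀ {w t} → 2 ≤ t → t ≤ e → Blocked w → ¬ Blocked (w + t)
  blocked-gap {w} {t} 2≤t t≤e = gap
    where
    low≤ : ∀ {b} → b ≤ 1 → b ≤ q + e
    low≤ {b} b≤1 = linear-≤ (b≤1 ⊕ 2≤e) (1 + q) (solve (b ∷ q ∷ e ∷ []))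
    equal : ∀ b b′ → w ≈ b → w + t ≈ b′ → b ≤ q + e → b′ ≤ q + e → b + t ≡ b′
    equal b b′ w≈ w+t≈ b≤ b′≤ = ≈⇒≡ (linear-≈ ((≈-sym w≈) ⊞ w+t≈) (solve (b ∷ t ∷ b′ ∷ w ∷ [])))
      (linear-≤ (b≤ ⊕ t≤e ⊕ (≤-reflexive p≡) ⊕ 2e<q) (b′ + e) (solve (b ∷ t ∷ b′ ∷ p ∷ q ∷ e ∷ [])))
      (linear-≤ (b′≤ ⊕ 2≤t ⊕ (≤-reflexive p≡)) (1 + b + q) (solve (b′ ∷ b ∷ t ∷ p ∷ q ∷ e ∷ [])))
    low-low : ∀ b b′ → b ≤ 1 → b′ ≤ 1 → ¬ b + t ≡ b′
    low-low b b′ b≤ b′≤ h = linear-⊥ (b′≤ ⊕ 2≤t ⊕ (≤-reflexive h)) b (solve (b′ ∷ t ∷ b ∷ []))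
    low-high : ∀ b b′ → b ≤ 1 → q + e ≤ b′ + 1 → ¬ b + t ≡ b′
    low-high b b′ b≤ ≤b′ h = linear-⊥ (b≤ ⊕ ≤b′ ⊕ t≤e ⊕ (≤-reflexive (sym h)) ⊕ 2e<q ⊕ 2≤e) e
        (solve (b ∷ q ∷ e ∷ b′ ∷ t ∷ []))
    high-low : ∀ b b′ → b′ ≤ 1 → ¬ b + t ≡ b′
    high-low b b′ b′≤ h = linear-⊥ (b′≤ ⊕ 2≤t ⊕ (≤-reflexive h)) b (solve (b′ ∷ t ∷ b ∷ []))
    high-high : ∀ b b′ → q + e ≤ b + 1 → b′ ≤ q + e → ¬ b + t ≡ b′
    high-high b b′ ≤b b′≤ h = linear-⊥ (≤b ⊕ b′≤ ⊕ 2≤t ⊕ (≤-reflexive h)) 0 (solve (q ∷ e ∷ b ∷ b′ ∷ t ∷ []))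
    gap : Blocked w → ¬ Blocked (w + t)
    gap (low b w≈ b≤) (low b′ w+t≈ b′≤) = low-low b b′ b≤ b′≤ (equal b b′ w≈ w+t≈ (low≤ b≤) (low≤ b′≤))
    gap (low b w≈ b≤) (high b′ w+t≈ ≤b′ b′≤) = low-high b b′ b≤ ≤b′ (equal b b′ w≈ w+t≈ (low≤ b≤) b′≤)
    gap (high b w≈ ≤b b≤) (low b′ w+t≈ b′≤) = high-low b b′ b′≤ (equal b b′ w≈ w+t≈ b≤ (low≤ b′≤))
    gap (high b w≈ ≤b b≤) (high b′ w+t≈ ≤b′ b′≤) = high-high b b′ ≤b b′≤ (equal b b′ w≈ w+t≈ b≤ b′≤)

  -- Homomorphisms from the circular clique without the chords

  -- This is what a homomorphism of lifts guarantees on a single sheet: it preserves the rim edges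
  -- x, x + q and every edge with an end that is not a chord end.
  record SafeHom (F : ℕ → ℕ) : Set where
    field
      resp : ∀ {x y} → x ≈ y → F x ≈ F y
      rim  : ∀ x → Adj (F x) (F (x + q))
      free : ∀ x j → j ≤ e → ¬ Blocked x → Adj (F x) (F (x + q + j))

  module SafeHomProperties {F : ℕ → ℕ} (F-safe : SafeHom F) where
    open SafeHom F-safe

    rim-walk : ∀ m x → Reach m (F x) (F (x + m * q))
    rim-walk zero x = Reach-refl (resp (≈-reflexive (sym (+-identityʳ x))))
    rim-walk (suc m) x = subst (λ y → Reach (suc m) (F x) (F y)) (+-assoc x q (m * q))
      (Reach-trans (Adj⇒Reach (rim x)) (rim-walk m (x + q)))

    -- Otherwise a walk of length 2r + 1 from w to w + t that avoids the two chords is mapped to an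
    -- odd closed walk shorter than the odd girth.
    separated : ∀ w t → 1 ≤ t → t ≤ e → ¬ F w ≈ F (w + t)
    separated w (suc t) _ t<e Fw≈ with blocked? w
    ... | no ¬b = <-irrefl refl (odd-closed r
        (Reach-trans (Adj⇒Reach (free w t (<⇒≤ t<e) ¬b)) (rim-walk (r + r) (w + q + t)))
        (≈-trans Fw≈ (resp {w + suc t} {w + q + t + (r + r) * q} (linear-≈ (≈-sym kq≈1)
            (solve (w ∷ t ∷ q ∷ r ∷ []))))))
    separated w (suc zero) _ t<e Fw≈ | yes b = <-irrefl refl (odd-closed r (rim-walk (suc (r + r)) w)
        (≈-trans Fw≈ (resp {w + 1} {w + suc (r + r) * q} (linear-≈ (≈-sym kq≈1) (solve (w ∷ r ∷ q ∷ []))))))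
    separated w (suc (suc t)) _ t<e Fw≈ | yes b with complement (≤-trans (n≤1+n (suc t)) t<e)
    ... | j , t+j≡e = <-irrefl refl (odd-closed r
        (subst (λ l → Reach l (F w) (F (w + suc (suc t)))) (+-comm (r + r) 1)
          (Reach-trans (rim-walk (r + r) w) (Adj⇒Reach last-step)))
        Fw≈)
      where
      -- After 2r rim steps the walk is at w + 1 - q. Its last edge is justified from the other end
      -- w + t, which is not a chord end, with offset e + 1 - t for the full distance t.
      last-step : Adj (F (w + (r + r) * q)) (F (w + suc (suc t)))
      last-step = Adj-resp
        (resp {w + suc (suc t) + q + j} {w + (r + r) * q} (linear-≈ ((≈-reflexive t+j≡e) ⊞ (≈-sym kq≈1) ⊞ p≈0)
            (solve (w ∷ t ∷ q ∷ j ∷ r ∷ e ∷ []))))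
        ≈-refl
        (Adj-sym (free (w + suc (suc t)) j (linear-≤ (≤-reflexive t+j≡e) (1 + t)
            (solve (j ∷ e ∷ t ∷ []))) (blocked-gap (s≤s (s≤s z≤n)) t<e b)))

    -- The e common neighbours of y and y + 1 lie within distance e of each other, so `separated`
    -- keeps their images distinct and `common-neighbours` applies.
    consecutive : ∀ y → 2 ≤ y → y + 3 ≤ q + e → F (y + 1) ≈ F y + 1 ⊎ F y ≈ F (y + 1) + 1
    consecutive y 2≤y y+3≤ = [ ⊥-elim ∘ separated y 1 ≤-refl 1≤e , (λ h → h) ]′
      (common-neighbours (F y) (F (y + 1)) w w-injective
        (λ i → Adj-resp ≈-refl (resp (shift y (toℕ i)))
          (free y (suc (toℕ i)) (toℕ<n i) (unblocked {y} 2≤y (linear-≤ y+3≤ 1 (solve (y ∷ q ∷ e ∷ []))))))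
        (λ i → free (y + 1) (toℕ i) (<⇒≤ (toℕ<n i)) (unblocked {y + 1} (linear-≤ 2≤y 1
            (solve (y ∷ []))) (linear-≤ y+3≤ 0 (solve (y ∷ q ∷ e ∷ []))))))
      where
      1≤e : 1 ≤ e
      1≤e = ≤-trans (s≤s z≤n) 2≤e
      shift : ∀ y i → y + q + suc i ≈ y + 1 + q + i
      shift y i = linear-≈ (≈-refl {0}) (solve (y ∷ q ∷ i ∷ []))
      w : Fin e → ℕ
      w i = F (y + 1 + q + toℕ i)
      distinct : ∀ {i j} → j ≤ e → i < j → ¬ F (y + 1 + q + i) ≈ F (y + 1 + q + j)
      distinct {i} {j} j≤e i<j F≈ with complement i<j
      ... | t , i+t≡j = separated (y + 1 + q + i) (suc t) (s≤s z≤n)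
        (linear-≤ ((≤-reflexive i+t≡j) ⊕ j≤e) i (solve (t ∷ e ∷ i ∷ j ∷ [])))
        (≈-trans F≈ (resp {y + 1 + q + j} {y + 1 + q + i + suc t} (linear-≈ (≈-reflexive (sym i+t≡j))
            (solve (y ∷ q ∷ j ∷ i ∷ t ∷ [])))))
      w-injective : ∀ {i j} → w i ≈ w j → i ≡ j
      w-injective {i} {j} w≈ with <-cmp (toℕ i) (toℕ j)
      ... | tri< i<j _ _ = ⊥-elim (distinct (<⇒≤ (toℕ<n j)) i<j w≈)
      ... | tri≈ _ i≡j _ = toℕ-injective i≡j
      ... | tri> _ _ j<i = ⊥-elim (distinct (<⇒≤ (toℕ<n i)) j<i (≈-sym w≈))

    module Normalised (F2 : F 2 ≈ 2) (F3 : F 3 ≈ 3) where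

      Fixed : ℕ → Set
      Fixed x = F x ≈ x

      Fixed-resp : ∀ {x y} → x ≈ y → Fixed x → Fixed y
      Fixed-resp x≈y Fx = ≈-trans (≈-sym (resp x≈y)) (≈-trans Fx x≈y)

      -- Two successive fixed vertices are carried along: the next image is one place up or down,
      -- and going down would identify the images of two vertices at distance 2.
      fixed-pair : ∀ i → i + 5 ≤ q + e → Fixed (2 + i) × Fixed (3 + i)
      fixed-pair zero _ = F2 , F3
      fixed-pair (suc i) i+6≤ with fixed-pair i (<⇒≤ i+6≤)
      ... | F2+i , F3+i = F3+i , Fixed-resp (≈-reflexive (+-comm (3 + i) 1)) ([ ascend , ⊥-elim ∘ descend ]′
          (consecutive (3 + i) (s≤s (s≤s z≤n)) (linear-≤ i+6≤ 0 (solve (i ∷ q ∷ e ∷ [])))))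
        where
        ascend : F (3 + i + 1) ≈ F (3 + i) + 1 → Fixed (3 + i + 1)
        ascend h = ≈-trans h (F3+i ⊞ ≈-refl)
        cancel : ∀ {a b} → a ≈ b + 1 → a ≈ 3 + i → b ≈ 2 + i
        cancel {a} {b} h₁ h₂ = linear-≈ ((≈-sym h₁) ⊞ h₂) (solve (b ∷ i ∷ a ∷ []))
        descend : ¬ F (3 + i) ≈ F (3 + i + 1) + 1
        descend h = separated (2 + i) 2 (s≤s z≤n) 2≤e (≈-trans F2+i (≈-trans (≈-sym (cancel h F3+i))
          (resp {3 + i + 1} {2 + i + 2} (linear-≈ (≈-refl {0}) (solve (i ∷ []))))))

      fixed-low : ∀ x → 2 ≤ x → x + 2 ≤ q + e → Fixed x
      fixed-low (suc (suc zero)) _ _ = F2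
      fixed-low (suc (suc (suc i))) _ x≤ = proj₂ (fixed-pair i (linear-≤ x≤ 0 (solve (i ∷ q ∷ e ∷ []))))
      fixed-low (suc zero) (s≤s ()) _

      -- Rim edges join x to x - q - e and x - q. Both are fixed by `fixed-low`, and x is their only
      -- common neighbour by `pinch`.
      fixed-high : ∀ x → q + e + 2 ≤ x → x + 2 ≤ q + q + e → Fixed x
      fixed-high x ≤x x≤ with complement ≤x
      ... | i , refl = ≈-trans (pinch
              (Adj-resp ≈-refl ≈-refl (Adj-sym (Adj-resp ≈-refl (≈-trans (resp lower) (fixed-low (2 + i) (s≤s
                  (s≤s z≤n)) i≤)) (rim x))))
              (Adj-resp (fixed-low (2 + i + e) (s≤s (s≤s z≤n)) i+e≤) (resp upper) (rim (2 + i + e))))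
            upper
        where
        lower : q + e + 2 + i + q ≈ 2 + i
        lower = linear-≈ p≈0 (solve (q ∷ e ∷ i ∷ []))
        upper : 2 + i + e + q ≈ q + e + 2 + i
        upper = linear-≈ (≈-refl {0}) (solve (i ∷ e ∷ q ∷ []))
        i≤ : 2 + i + 2 ≤ q + e
        i≤ = linear-≤ x≤ e (solve (i ∷ q ∷ e ∷ []))
        i+e≤ : 2 + i + e + 2 ≤ q + e
        i+e≤ = linear-≤ x≤ 0 (solve (i ∷ e ∷ q ∷ []))

      -- If x and all its neighbours except an extreme one are fixed, then so is that one:
      -- the other neighbours of x are already taken.
      extend-down : ∀ x → Fixed x → (∀ j → j < e → Fixed (x + q + suc j)) → Fixed (x + q)
      extend-down x Fx fixed = last (rim x)
        where
        last : Adj (F x) (F (x + q)) → Fixed (x + q)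
        last (step zero _ y≈) = ≈-trans y≈ (lemma Fx)
          where
          lemma : ∀ {z} → z ≈ x → z + q + 0 ≈ x + q
          lemma {z} h = linear-≈ h (solve (z ∷ q ∷ x ∷ []))
        last (step (suc j) j<e y≈) = ⊥-elim (separated (x + q) (suc j) (s≤s z≤n) j<e
            (≈-trans (≈-trans y≈ (lemma Fx)) (≈-sym (fixed j j<e))))
          where
          lemma : ∀ {z} → z ≈ x → z + q + suc j ≈ x + q + suc j
          lemma {z} h = linear-≈ h (solve (z ∷ q ∷ j ∷ x ∷ []))

      extend-up : ∀ x → Fixed x → (∀ j → j < e → Fixed (x + q + j)) → Fixed (x + q + e)
      extend-up x Fx fixed = last (Adj-sym (Adj-resp ≈-refl (resp wrap) (rim (x + q + e))))
        where
        wrap : x + q + e + q ≈ x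
        wrap = linear-≈ p≈0 (solve (x ∷ q ∷ e ∷ []))
        lemma : ∀ {z} j → z ≈ x → z + q + j ≈ x + q + j
        lemma {z} j h = linear-≈ h (solve (z ∷ q ∷ j ∷ x ∷ []))
        last : Adj (F x) (F (x + q + e)) → Fixed (x + q + e)
        last (step j j≤e y≈) with m≤n⇒m<n∨m≡n j≤e
        ... | inj₂ refl = ≈-trans y≈ (lemma e Fx)
        ... | inj₁ j<e with complement j<e
        ...   | t , j+t≡e = ⊥-elim (separated (x + q + j) (suc t) (s≤s z≤n) (linear-≤ (≤-reflexive j+t≡e) j
            (solve (t ∷ e ∷ j ∷ [])))
                (≈-trans (fixed j j<e) (≈-trans (≈-sym (≈-trans y≈ (lemma j Fx)))
                  (resp {x + q + e} {x + q + j + suc t} (linear-≈ (≈-reflexive (sym j+t≡e))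
                      (solve (x ∷ q ∷ e ∷ j ∷ t ∷ [])))))))

      -- What remains are the chord ends and the vertices q + e + 1 and p - 1. They are treated in
      -- the order q + e + 1, q + e, p - 1, q + e - 1, 0, 1: each is an extreme neighbour of a fixed
      -- vertex all of whose other neighbours are fixed by then.
      module _ (q₁ : ℕ) (q≡1+q₁ : suc q₁ ≡ q) where

        fixed-q+e+1 : Fixed (e + 1 + q)
        fixed-q+e+1 = extend-down (e + 1)
          (fixed-low (e + 1) (linear-≤ 2≤e 1 (solve (e ∷ []))) (linear-≤ (2e<q ⊕ 2≤e) e (solve (e ∷ q ∷ []))))
          λ j j<e → fixed-high (e + 1 + q + suc j) (linear-≤ (z≤n {0}) j (solve (q ∷ e ∷ j ∷ [])))
            (linear-≤ (j<e ⊕ 2e<q ⊕ 2≤e) 0 (solve (e ∷ q ∷ j ∷ [])))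

        fixed-q+e : Fixed (e + q)
        fixed-q+e = extend-down e
          (fixed-low e 2≤e (linear-≤ (2e<q ⊕ 2≤e) (1 + e) (solve (e ∷ q ∷ []))))
          λ where
            zero _ → Fixed-resp {e + 1 + q} {e + q + 1} (linear-≈ (≈-refl {0}) (solve (e ∷ q ∷ []))) fixed-q+e+1
            (suc j) j<e → fixed-high (e + q + suc (suc j)) (linear-≤ (z≤n {0}) j (solve (q ∷ e ∷ j ∷ [])))
              (linear-≤ (j<e ⊕ 2e<q ⊕ 2≤e) 1 (solve (e ∷ q ∷ j ∷ [])))

        fixed-p-1 : Fixed (q₁ + q + e)
        fixed-p-1 = extend-up q₁
          (fixed-low q₁ (linear-≤ ((≤-reflexive (sym q≡1+q₁)) ⊕ 2e<q ⊕ 2≤e) e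
              (solve (q₁ ∷ q ∷ e ∷ []))) (linear-≤ ((≤-reflexive q≡1+q₁) ⊕ 2≤e) 1 (solve (q₁ ∷ q ∷ e ∷ []))))
          λ j j<e → fixed-high (q₁ + q + j) (linear-≤ ((≤-reflexive (sym q≡1+q₁)) ⊕ 2e<q ⊕ 2≤e) j
              (solve (q ∷ e ∷ q₁ ∷ j ∷ [])))
            (linear-≤ ((≤-reflexive q≡1+q₁) ⊕ j<e) 0 (solve (q₁ ∷ q ∷ j ∷ e ∷ [])))

        fixed-q+e-1 : Fixed (q₁ + e)
        fixed-q+e-1 = Fixed-resp {q₁ + q + e + q + e} {q₁ + e} (linear-≈ p≈0 (solve (q₁ ∷ q ∷ e ∷ [])))
          (extend-up (q₁ + q + e) fixed-p-1
            λ j j<e → Fixed-resp {q₁ + j} {q₁ + q + e + q + j} (linear-≈ (≈-sym p≈0)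
                (solve (q₁ ∷ j ∷ q ∷ e ∷ [])))
              (fixed-low (q₁ + j) (linear-≤ ((≤-reflexive (sym q≡1+q₁)) ⊕ 2e<q ⊕ 2≤e) (e + j)
                  (solve (q₁ ∷ j ∷ q ∷ e ∷ [])))
                (linear-≤ ((≤-reflexive q≡1+q₁) ⊕ j<e) 0 (solve (q₁ ∷ j ∷ q ∷ e ∷ [])))))

        fixed-0 : Fixed 0
        fixed-0 = Fixed-resp p≈0 (extend-up q
          (fixed-low q (linear-≤ (2e<q ⊕ 2≤e) (1 + e) (solve (q ∷ e ∷ []))) (linear-≤ 2≤e 0
              (solve (q ∷ e ∷ []))))
          λ j j<e → [ (λ (j+1<e : suc j < e) → fixed-high (q + q + j) (linear-≤ (2e<q ⊕ 2≤e) (1 + j)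
              (solve (q ∷ e ∷ j ∷ [])))
                        (linear-≤ j+1<e 0 (solve (q ∷ j ∷ e ∷ []))))
                    , (λ (j+1≡e : suc j ≡ e) → Fixed-resp {q₁ + q + e} {q + q + j} (linear-≈ ((≈-reflexive
                        (sym j+1≡e)) ⊞ (≈-reflexive q≡1+q₁)) (solve (q₁ ∷ q ∷ e ∷ j ∷ []))) fixed-p-1) ]′
                    (m≤n⇒m<n∨m≡n j<e))

        fixed-1 : Fixed 1
        fixed-1 = Fixed-resp {e + 1 + q + q} {1} (linear-≈ p≈0
            (solve (e ∷ q ∷ []))) (extend-down (e + 1 + q) fixed-q+e+1
          λ j j<e → Fixed-resp {2 + j} {e + 1 + q + q + suc j} (linear-≈ (≈-sym p≈0) (solve (j ∷ e ∷ q ∷ [])))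
            (fixed-low (2 + j) (s≤s (s≤s z≤n)) (linear-≤ (j<e ⊕ 2e<q ⊕ 2≤e) e (solve (j ∷ q ∷ e ∷ [])))))

        fixed-< : ∀ x → x < p → Fixed x
        fixed-< zero _ = fixed-0
        fixed-< (suc zero) _ = fixed-1
        fixed-< x@(suc (suc _)) x<p with ≤-<-connex (x + 2) (q + e)
        ... | inj₁ x≤ = fixed-low x (s≤s (s≤s z≤n)) x≤
        ... | inj₂ x> with ≤-<-connex (q + e + 2) x
        ...   | inj₁ ≤x with m≤n⇒m<n∨m≡n x<p
        ...     | inj₁ x+1<p = fixed-high x ≤x (subst (x + 2 ≤_) (sym p≡) (subst (_≤ p) (+-comm 2 x) x+1<p))
        ...     | inj₂ x+1≡p = Fixed-resp (≈-reflexive (lemma x+1≡p)) fixed-p-1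
          where
          lemma : ∀ {x} → suc x ≡ p → q₁ + q + e ≡ x
          lemma {x} h = linear-≡ ((sym h) ⊹ p≡ ⊹ q≡1+q₁) (solve (q₁ ∷ q ∷ e ∷ x ∷ p ∷ []))
        fixed-< x@(suc (suc _)) x<p | inj₂ x> | inj₂ x< with <-cmp x (q + e)
        ... | tri< x<q+e _ _ = Fixed-resp (≈-reflexive (≤-antisym (lower x>) (upper x<q+e))) fixed-q+e-1
          where
          lower : ∀ {x} → q + e < x + 2 → q₁ + e ≤ x
          lower {x} h = linear-≤ (h ⊕ (≤-reflexive q≡1+q₁)) 0 (solve (q₁ ∷ e ∷ x ∷ q ∷ []))
          upper : ∀ {x} → x < q + e → x ≤ q₁ + e
          upper {x} h = linear-≤ (h ⊕ (≤-reflexive (sym q≡1+q₁))) 0 (solve (x ∷ q₁ ∷ e ∷ q ∷ []))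
        ... | tri≈ _ x≡q+e _ = Fixed-resp (≈-reflexive (trans (+-comm e q) (sym x≡q+e))) fixed-q+e
        ... | tri> _ _ q+e<x = Fixed-resp (≈-reflexive (≤-antisym (lower q+e<x) (upper x<))) fixed-q+e+1
          where
          lower : ∀ {x} → q + e < x → e + 1 + q ≤ x
          lower {x} h = linear-≤ h 0 (solve (e ∷ q ∷ x ∷ []))
          upper : ∀ {x} → x < q + e + 2 → x ≤ e + 1 + q
          upper {x} h = linear-≤ h 0 (solve (x ∷ e ∷ q ∷ []))

      fixed : ∀ x → Fixed x
      fixed x = Fixed-resp (%-≈ x) (fixed-< (q ∸ 1) (m+[n∸m]≡n {1} {q} (linear-≤ 2e<q (2 * e)
          (solve (q ∷ e ∷ [])))) (x % p) (m%n<n x p))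

  -- Rotations and reflections

  data Affine (F : ℕ → ℕ) : Set where
    rotation   : ∀ a → (∀ x → F x ≈ a + x) → Affine F
    reflection : ∀ a → (∀ x → F x + x ≈ a) → Affine F

  SafeHom-translate : ∀ {F} s → SafeHom F → SafeHom (λ x → F x + s)
  SafeHom-translate {F} s F-safe = record
    { resp = λ x≈y → resp x≈y ⊞ ≈-refl
    ; rim  = λ x → translate (rim x)
    ; free = λ x j j≤e ¬b → translate (free x j j≤e ¬b)
    }
    where
    open SafeHom F-safe
    translate : ∀ {x y} → Adj x y → Adj (x + s) (y + s)
    translate {x} {y} (step j j≤e y≈) = step j j≤e (linear-≈ y≈ (solve (y ∷ s ∷ x ∷ q ∷ j ∷ [])))

  SafeHom-negate : ∀ {F} → SafeHom F → SafeHom (λ x → neg (F x))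
  SafeHom-negate {F} F-safe = record
    { resp = λ x≈y → neg-cong (resp x≈y)
    ; rim  = λ x → negate (rim x)
    ; free = λ x j j≤e ¬b → negate (free x j j≤e ¬b)
    }
    where
    open SafeHom F-safe
    cancel : ∀ {x y x′ y′} → x ≈ y → x + x′ ≈ 0 → y + y′ ≈ 0 → x′ ≈ y′
    cancel {x} {y} {x′} {y′} h h₁ h₂ = linear-≈ ((≈-sym h) ⊞ h₁ ⊞ (≈-sym h₂)) (solve (x′ ∷ y′ ∷ x ∷ y ∷ []))
    neg-cong : ∀ {x y} → x ≈ y → neg x ≈ neg y
    neg-cong {x} {y} x≈y = cancel x≈y (neg-inverse x) (neg-inverse y)
    reverse : ∀ {x y x′ y′} j → y ≈ x + q + j → x + x′ ≈ 0 → y + y′ ≈ 0 → x′ ≈ y′ + q + j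
    reverse {x} {y} {x′} {y′} j h h₁ h₂ = linear-≈ (h ⊞ h₁ ⊞ (≈-sym h₂)) (solve (x′ ∷ y′ ∷ q ∷ j ∷ y ∷ x ∷ []))
    negate : ∀ {x y} → Adj x y → Adj (neg x) (neg y)
    negate {x} {y} (step j j≤e y≈) = Adj-sym (step j j≤e (reverse j y≈ (neg-inverse x) (neg-inverse y)))

  -- The images of 2 and 3 are consecutive. A translation, preceded by a negation if they descend,
  -- brings them to 2 and 3, and then every vertex is fixed.
  affine : ∀ {F} → SafeHom F → Affine F
  affine {F} F-safe = [ rotate , reflect ]′
      (SafeHomProperties.consecutive F-safe 2 ≤-refl (linear-≤ (2≤e ⊕ 2≤e ⊕ 2e<q) e (solve (q ∷ e ∷ []))))
    where
    rotate : F 3 ≈ F 2 + 1 → Affine F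
    rotate h = rotation (neg s) λ x → shift x (SafeHomProperties.Normalised.fixed (SafeHom-translate s F-safe)
        (lemma (neg-inverse (F 2))) (≈-trans (h ⊞ ≈-refl) (lemma′ (neg-inverse (F 2)))) x) (neg-inverse s)
      where
      s = 2 + neg (F 2)
      lemma : ∀ {a b} → a + b ≈ 0 → a + (2 + b) ≈ 2
      lemma {a} {b} h = linear-≈ h (solve (a ∷ b ∷ []))
      lemma′ : ∀ {a b} → a + b ≈ 0 → a + 1 + (2 + b) ≈ 3
      lemma′ {a} {b} h = linear-≈ h (solve (a ∷ b ∷ []))
      shift : ∀ {y s t} x → y + s ≈ x → s + t ≈ 0 → y ≈ t + x
      shift {y} {s} {t} x h₁ h₂ = linear-≈ (h₁ ⊞ (≈-sym h₂)) (solve (y ∷ t ∷ x ∷ s ∷ []))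
    reflect : F 2 ≈ F 3 + 1 → Affine F
    reflect h = reflection (2 + F 2) λ x → shift (neg-inverse (F x))
        (SafeHomProperties.Normalised.fixed (SafeHom-translate (2 + F 2) (SafeHom-negate F-safe))
          (lemma (neg-inverse (F 2))) (lemma′ h (neg-inverse (F 3))) x)
      where
      lemma : ∀ {a b} → a + b ≈ 0 → b + (2 + a) ≈ 2
      lemma {a} {b} h = linear-≈ h (solve (b ∷ a ∷ []))
      lemma′ : ∀ {a b c} → a ≈ b + 1 → b + c ≈ 0 → c + (2 + a) ≈ 3
      lemma′ {a} {b} {c} h₁ h₂ = linear-≈ (h₁ ⊞ h₂) (solve (c ∷ a ∷ b ∷ []))
      shift : ∀ {x y z s} → y + z ≈ 0 → z + s ≈ x → y + x ≈ s
      shift {x} {y} {z} {s} h₁ h₂ = linear-≈ (h₁ ⊞ (≈-sym h₂)) (solve (y ∷ x ∷ s ∷ z ∷ []))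

  -- The chords as labelled steps

  -- Chord i joins `P i` to `Q i`. It has offset e - 1 from `P i` and offset 1 from `Q i`; neither
  -- is 0, so the chords are not rim edges.
  P Q : Bool → ℕ
  P false = 0
  P true  = 1
  Q i = q + e₁ + P i

  P≤1 : ∀ i → P i ≤ 1
  P≤1 false = z≤n
  P≤1 true  = ≤-refl

  P-injective : ∀ {i j} → P i ≈ P j → i ≡ j
  P-injective {i} {j} h = ≡-injective (≈⇒≡ h (bound (P≤1 i)) (bound (P≤1 j)))
    where
    bound : ∀ {a b} → a ≤ 1 → a < b + p
    bound {a} {b} a≤1 = linear-≤ (a≤1 ⊕ 2≤e ⊕ (≤-reflexive p≡)) (b + 2 * q) (solve (a ∷ b ∷ p ∷ e ∷ q ∷ []))
    ≡-injective : ∀ {i j} → P i ≡ P j → i ≡ j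
    ≡-injective {false} {false} _ = refl
    ≡-injective {true}  {true}  _ = refl

  Q-injective : ∀ {i j} → Q i ≈ Q j → i ≡ j
  Q-injective h = P-injective (lemma h)
    where
    lemma : ∀ {a b} → q + e₁ + a ≈ q + e₁ + b → a ≈ b
    lemma {a} {b} h = linear-≈ h (solve (a ∷ b ∷ q ∷ e₁ ∷ []))

  P≉Q : ∀ {i j} → ¬ P i ≈ Q j
  P≉Q {i} {j} h = lemma (P≤1 i) (P≤1 j) h
    where
    lemma : ∀ {a b} → a ≤ 1 → b ≤ 1 → ¬ a ≈ q + e₁ + b
    lemma {a} {b} a≤ b≤ h = linear-⊥ (a≤ ⊕ (≤-reflexive (sym a≡)) ⊕ 2e<q ⊕ 2≤e) (1 + b + e + e₁)
        (solve (a ∷ q ∷ e₁ ∷ b ∷ e ∷ []))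
      where
      a≡ : a ≡ q + e₁ + b
      a≡ = ≈⇒≡ h (linear-≤ (a≤ ⊕ (≤-reflexive p≡) ⊕ 2≤e) (b + e₁ + 3 * q) (solve (a ∷ q ∷ e₁ ∷ b ∷ p ∷ e ∷ [])))
                 (linear-≤ (b≤ ⊕ (≤-reflexive p≡) ⊕ (≤-reflexive e≡) ⊕ 2e<q) (a + 2 * e)
                     (solve (q ∷ e₁ ∷ b ∷ a ∷ p ∷ e ∷ [])))

  P-blocked : ∀ {x} i → x ≈ P i → Blocked x
  P-blocked i x≈ = low (P i) x≈ (P≤1 i)

  Q-blocked : ∀ {x} i → x ≈ Q i → Blocked x
  Q-blocked i x≈ = high (Q i) x≈ (lower (P i)) (upper (P≤1 i))
    where
    lower : ∀ b → q + e ≤ q + e₁ + b + 1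
    lower b = linear-≤ (≤-reflexive (sym e≡)) b (solve (q ∷ e ∷ e₁ ∷ b ∷ []))
    upper : ∀ {b} → b ≤ 1 → q + e₁ + b ≤ q + e
    upper {b} b≤ = linear-≤ ((≤-reflexive e≡) ⊕ b≤) 0 (solve (q ∷ e₁ ∷ b ∷ e ∷ []))

  Q+q+1≈P : ∀ i → Q i + q + 1 ≈ P i
  Q+q+1≈P i = lemma (P i)
    where
    lemma : ∀ b → q + e₁ + b + q + 1 ≈ b
    lemma b = linear-≈ (p≈0 ⊞ (≈-reflexive e≡)) (solve (q ∷ e₁ ∷ b ∷ e ∷ []))

  P+q+e₁≈Q : ∀ i → P i + q + e₁ ≈ Q i
  P+q+e₁≈Q i = lemma (P i)
    where
    lemma : ∀ b → b + q + e₁ ≈ q + e₁ + b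
    lemma b = linear-≈ (≈-refl {0}) (solve (b ∷ q ∷ e₁ ∷ []))

  -- The step of offset j from x runs along a chord, `out` from its P end or `back` from its Q end.
  data Port (x j : ℕ) : Set where
    out  : ∀ i → x ≈ P i → j ≡ e₁ → Port x j
    back : ∀ i → x ≈ Q i → j ≡ 1 → Port x j

  Port-blocked : ∀ {x j} → Port x j → Blocked x
  Port-blocked (out i x≈ _)  = P-blocked i x≈
  Port-blocked (back i x≈ _) = Q-blocked i x≈

  Port-resp : ∀ {x y j} → x ≈ y → Port x j → Port y j
  Port-resp x≈y (out i x≈ j≡)  = out i (≈-trans (≈-sym x≈y) x≈) j≡
  Port-resp x≈y (back i x≈ j≡) = back i (≈-trans (≈-sym x≈y) x≈) j≡

  out-end : ∀ {x y j} i → y ≈ x + q + j → x ≈ P i → j ≡ e₁ → y ≈ Q i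
  out-end {x} {y} {j} i y≈ x≈ refl = ≈-trans (lemma y≈ x≈) (P+q+e₁≈Q i)
    where
    lemma : ∀ {b} → y ≈ x + q + j → x ≈ b → y ≈ b + q + j
    lemma {b} h₁ h₂ = linear-≈ (h₁ ⊞ h₂) (solve (y ∷ b ∷ q ∷ j ∷ x ∷ []))

  back-end : ∀ {x y j} i → y ≈ x + q + j → x ≈ Q i → j ≡ 1 → y ≈ P i
  back-end {x} {y} {j} i y≈ x≈ refl = ≈-trans (lemma y≈ x≈) (Q+q+1≈P i)
    where
    lemma : ∀ {b} → y ≈ x + q + 1 → x ≈ b → y ≈ b + q + 1
    lemma {b} h₁ h₂ = linear-≈ (h₁ ⊞ h₂) (solve (y ∷ b ∷ q ∷ x ∷ []))

  e₁⇒1 : ∀ {j j′} → j + j′ ≡ e → j ≡ e₁ → j′ ≡ 1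
  e₁⇒1 {j} {j′} h refl = linear-≡ (h ⊹ (sym e≡)) (solve (j′ ∷ j ∷ e ∷ []))

  1⇒e₁ : ∀ {j j′} → j + j′ ≡ e → j ≡ 1 → j′ ≡ e₁
  1⇒e₁ {j} {j′} h refl = linear-≡ (h ⊹ (sym e≡)) (solve (j′ ∷ e₁ ∷ e ∷ []))

  Port-reverse : ∀ {x y j j′} → j + j′ ≡ e → y ≈ x + q + j → Port x j → Port y j′
  Port-reverse h y≈ (out i x≈ j≡)  = back i (out-end i y≈ x≈ j≡) (e₁⇒1 h j≡)
  Port-reverse h y≈ (back i x≈ j≡) = out i (back-end i y≈ x≈ j≡) (1⇒e₁ h j≡)

  port? : ∀ x j → Dec (Port x j)
  port? x j = map′ to from (end? false ⊎-dec end? true)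
    where
    End : Bool → Set
    End i = (x ≈ P i × j ≡ e₁) ⊎ (x ≈ Q i × j ≡ 1)
    end? : ∀ i → Dec (End i)
    end? i = ((x ≈? P i) ×-dec (j ≟ e₁)) ⊎-dec ((x ≈? Q i) ×-dec (j ≟ 1))
    port : ∀ i → End i → Port x j
    port i (inj₁ (x≈ , j≡)) = out i x≈ j≡
    port i (inj₂ (x≈ , j≡)) = back i x≈ j≡
    to : End false ⊎ End true → Port x j
    to = [ port false , port true ]′
    from : Port x j → End false ⊎ End true
    from (out false x≈ j≡)  = inj₁ (inj₁ (x≈ , j≡))
    from (out true x≈ j≡)   = inj₂ (inj₁ (x≈ , j≡))
    from (back false x≈ j≡) = inj₁ (inj₂ (x≈ , j≡))
    from (back true x≈ j≡)  = inj₂ (inj₂ (x≈ , j≡))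

  reverse-step : ∀ {x y j j′} → j + j′ ≡ e → y ≈ x + q + j → x ≈ y + q + j′
  reverse-step {x} {y} {j} {j′} h y≈ = linear-≈ ((≈-sym y≈) ⊞ (≈-reflexive (sym h)) ⊞ (≈-sym p≈0))
      (solve (x ∷ y ∷ q ∷ j′ ∷ j ∷ e ∷ []))

  step-unique : ∀ {x y j j′} → y ≈ x + q + j → y ≈ x + q + j′ → j ≤ e → j′ ≤ e → j ≡ j′
  step-unique {x} {y} {j} {j′} h h′ j≤ j′≤ = ≈⇒≡ (linear-≈ ((≈-sym h) ⊞ h′) (solve (j ∷ j′ ∷ y ∷ x ∷ q ∷ [])))
    (linear-≤ (j≤ ⊕ (≤-reflexive p≡) ⊕ 2e<q) (2 * e + j′ + q) (solve (j ∷ j′ ∷ p ∷ e ∷ q ∷ [])))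
    (linear-≤ (j′≤ ⊕ (≤-reflexive p≡) ⊕ 2e<q) (2 * e + j + q) (solve (j′ ∷ j ∷ p ∷ e ∷ q ∷ [])))

  near-nonadjacent : ∀ {x y j} a b → x + a ≈ y + b → a ≤ 1 → b ≤ 1 → j ≤ e → ¬ y ≈ x + q + j
  near-nonadjacent {x} {y} {j} a b h a≤ b≤ j≤ h′ = linear-⊥ (a≤ ⊕ (≤-reflexive (sym a≡)) ⊕ 2e<q ⊕ 2≤e)
      (1 + b + e + j) (solve (a ∷ q ∷ j ∷ b ∷ e ∷ []))
    where
    a≡ : a ≡ q + j + b
    a≡ = ≈⇒≡ (linear-≈ (h ⊞ h′) (solve (a ∷ q ∷ j ∷ b ∷ x ∷ y ∷ [])))
      (linear-≤ (a≤ ⊕ (≤-reflexive p≡) ⊕ 2≤e) (b + j + 3 * q) (solve (a ∷ q ∷ j ∷ b ∷ p ∷ e ∷ [])))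
      (linear-≤ (b≤ ⊕ j≤ ⊕ (≤-reflexive p≡) ⊕ 2e<q ⊕ 2≤e) (1 + a + e) (solve (q ∷ j ∷ b ∷ a ∷ p ∷ e ∷ [])))

  -- Lifts of the circular clique

  module Lift (S : Sheets) where
    open Sheets S

    -- The case `back` is stated through `σ` rather than its inverse, so that reversing a step
    -- merely exchanges `out` and `back`.
    data Transport (x j : ℕ) (c c′ : Fin size) : Set where
      out   : ∀ i → x ≈ P i → j ≡ e₁ → c′ ≡ σ i c → Transport x j c c′
      back  : ∀ i → x ≈ Q i → j ≡ 1 → c ≡ σ i c′ → Transport x j c c′
      plain : ¬ Port x j → c′ ≡ c → Transport x j c c′

    σ-injective : ∀ i {c c′} → σ i c ≡ σ i c′ → c ≡ c′
    σ-injective i {c} {c′} h = trans (sym (σ⁻σ i c)) (trans (cong (σ⁻ i) h) (σ⁻σ i c′))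

    transport : ∀ x j c → ∃ (Transport x j c)
    transport x j c with port? x j
    ... | yes (out i x≈ j≡)  = σ i c , out i x≈ j≡ refl
    ... | yes (back i x≈ j≡) = σ⁻ i c , back i x≈ j≡ (sym (σσ⁻ i c))
    ... | no ¬port = c , plain ¬port refl

    Transport-unique : ∀ {x j c c₁ c₂} → Transport x j c c₁ → Transport x j c c₂ → c₁ ≡ c₂
    Transport-unique (out i x≈ _ refl) (out i′ x≈′ _ refl) = cong (λ k → σ k _) (P-injective (≈-trans
        (≈-sym x≈) x≈′))
    Transport-unique (out _ x≈ _ _) (back _ x≈′ _ _) = ⊥-elim (P≉Q (≈-trans (≈-sym x≈) x≈′))
    Transport-unique (out i x≈ j≡ _) (plain ¬port _) = ⊥-elim (¬port (out i x≈ j≡))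
    Transport-unique (back _ x≈ _ _) (out _ x≈′ _ _) = ⊥-elim (P≉Q (≈-trans (≈-sym x≈′) x≈))
    Transport-unique (back i x≈ _ c≡) (back i′ x≈′ _ c≡′) with Q-injective {i} {i′} (≈-trans (≈-sym x≈) x≈′)
    ... | refl = σ-injective i (trans (sym c≡) c≡′)
    Transport-unique (back i x≈ j≡ _) (plain ¬port _) = ⊥-elim (¬port (back i x≈ j≡))
    Transport-unique (plain ¬port _) (out i x≈ j≡ _) = ⊥-elim (¬port (out i x≈ j≡))
    Transport-unique (plain ¬port _) (back i x≈ j≡ _) = ⊥-elim (¬port (back i x≈ j≡))
    Transport-unique (plain _ refl) (plain _ refl) = refl

    Transport-resp : ∀ {x y j c c′} → x ≈ y → Transport x j c c′ → Transport y j c c′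
    Transport-resp x≈y (out i x≈ j≡ c≡) = out i (≈-trans (≈-sym x≈y) x≈) j≡ c≡
    Transport-resp x≈y (back i x≈ j≡ c≡) = back i (≈-trans (≈-sym x≈y) x≈) j≡ c≡
    Transport-resp x≈y (plain ¬port c≡) = plain (¬port ∘ Port-resp (≈-sym x≈y)) c≡

    record Link (x : ℕ) (c : Fin size) (y : ℕ) (c′ : Fin size) : Set where
      constructor link
      field
        j   : ℕ
        j≤e : j ≤ e
        y≈  : y ≈ x + q + j
        transported : Transport x j c c′

    Link⇒Adj : ∀ {x c y c′} → Link x c y c′ → Adj x y
    Link⇒Adj (link j j≤e y≈ _) = step j j≤e y≈

    Link-resp : ∀ {x x′ y y′ c c′} → x ≈ x′ → y ≈ y′ → Link x c y c′ → Link x′ c y′ c′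
    Link-resp x≈x′ y≈y′ (link j j≤e y≈ t) = link j j≤e (Adj.y≈ (Adj-resp x≈x′ y≈y′ (step j j≤e y≈)))
        (Transport-resp x≈x′ t)

    Link-sym : ∀ {x c y c′} → Link x c y c′ → Link y c′ x c
    Link-sym {x} {c} {y} {c′} (link j j≤e y≈ t) = reverse (complement j≤e) t
      where
      reverse : (∃ λ j′ → j + j′ ≡ e) → Transport x j c c′ → Link y c′ x c
      reverse (j′ , h) t = link j′ (subst (j′ ≤_) h (m≤n+m j′ j)) (reverse-step h y≈) (reverse-transport t)
        where
        reverse-transport : Transport x j c c′ → Transport y j′ c′ c
        reverse-transport (out i x≈ j≡ c≡) = back i (out-end i y≈ x≈ j≡) (e₁⇒1 h j≡) c≡
        reverse-transport (back i x≈ j≡ c≡) = out i (back-end i y≈ x≈ j≡) (1⇒e₁ h j≡) c≡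
        reverse-transport (plain ¬port c≡) =
          plain (¬port ∘ Port-reverse (trans (+-comm j′ j) h) (reverse-step h y≈)) (sym c≡)

    link-free : ∀ {x j} c → j ≤ e → ¬ Blocked x → Link x c (x + q + j) c
    link-free c j≤e ¬b = link _ j≤e ≈-refl (plain (¬b ∘ Port-blocked) refl)

    1≤e₁ : 1 ≤ e₁
    1≤e₁ = linear-≤ ((≤-reflexive (sym e≡)) ⊕ 2≤e) 0 (solve (e₁ ∷ e ∷ []))

    rim-port : ∀ {x} → ¬ Port x 0
    rim-port (out _ _ 0≡e₁) = <-irrefl 0≡e₁ 1≤e₁

    link-rim : ∀ x c → Link x c (x + q) c
    link-rim x c = link 0 z≤n (≈-reflexive (sym (+-identityʳ (x + q)))) (plain rim-port refl)

    link-chord : ∀ i c → Link (P i) c (Q i) (σ i c)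
    link-chord i c = link e₁ (≤-trans (n≤1+n e₁) (≤-reflexive e≡)) (≈-sym (P+q+e₁≈Q i)) (out i ≈-refl refl refl)

    link-rim⁻ : ∀ {x c y c′} → y ≈ x + q → Link x c y c′ → c′ ≡ c
    link-rim⁻ {x} {c} {y} {c′} y≈ (link j j≤e y≈′ t) = lemma (step-unique y≈′ (≈-trans y≈ (≈-reflexive (sym
        (+-identityʳ (x + q))))) j≤e z≤n) t
      where
      lemma : j ≡ 0 → Transport x j c c′ → c′ ≡ c
      lemma refl t = Transport-unique t (plain rim-port refl)

    link-chord⁻ : ∀ {x c y c′} i → x ≈ P i → y ≈ Q i → Link x c y c′ → c′ ≡ σ i c
    link-chord⁻ {x} {c} {y} {c′} i x≈ y≈ (link j j≤e y≈′ t) = Transport-unique t (out i x≈ j≡e₁ refl)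
      where
      j≡e₁ : j ≡ e₁
      j≡e₁ = step-unique y≈′ (≈-trans y≈ (≈-trans (≈-sym (P+q+e₁≈Q i)) (lemma x≈))) j≤e (≤-trans (n≤1+n e₁)
          (≤-reflexive e≡))
        where
        lemma : ∀ {b} → x ≈ b → b + q + e₁ ≈ x + q + e₁
        lemma {b} h = linear-≈ (≈-sym h) (solve (b ∷ q ∷ e₁ ∷ x ∷ []))

    -- A chord is mapped to such an edge when the chords are exchanged on just one of its two
    -- sheets. As the edge stays in its sheet, the two sheets are folded together.
    link-cross⁻ : ∀ {x c y c′} i i′ → i ≢ i′ → x ≈ P i → y ≈ Q i′ → Link x c y c′ → c′ ≡ c
    link-cross⁻ _ _ _ _ _ (link _ _ _ (plain _ c≡)) = c≡
    link-cross⁻ _ _ _ x≈ _ (link _ _ _ (back _ x≈′ _ _)) = ⊥-elim (P≉Q (≈-trans (≈-sym x≈) x≈′))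
    link-cross⁻ i i′ i≢i′ x≈ y≈ (link _ _ y≈′ (out k x≈′ j≡ _)) = ⊥-elim (i≢i′ (trans
      (P-injective (≈-trans (≈-sym x≈) x≈′)) (Q-injective (≈-trans (≈-sym (out-end k y≈′ x≈′ j≡)) y≈))))

    link-PP⁻ : ∀ {x c y c′} i i′ → x ≈ P i → y ≈ P i′ → ¬ Link x c y c′
    link-PP⁻ {x} {_} {y} i i′ x≈ y≈ (link j j≤e y≈′ _) =
      near-nonadjacent (P i′) (P i) (lemma x≈ y≈) (P≤1 i′) (P≤1 i) j≤e y≈′
      where
      lemma : ∀ {a b} → x ≈ a → y ≈ b → x + b ≈ y + a
      lemma {a} {b} h₁ h₂ = linear-≈ (h₁ ⊞ (≈-sym h₂)) (solve (x ∷ b ∷ y ∷ a ∷ []))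

    link-QQ⁻ : ∀ {x c y c′} i i′ → x ≈ Q i → y ≈ Q i′ → ¬ Link x c y c′
    link-QQ⁻ {x} {_} {y} i i′ x≈ y≈ (link j j≤e y≈′ _) =
      near-nonadjacent (P i′) (P i) (lemma x≈ y≈) (P≤1 i′) (P≤1 i) j≤e y≈′
      where
      lemma : ∀ {a b} → x ≈ q + e₁ + a → y ≈ q + e₁ + b → x + b ≈ y + a
      lemma {a} {b} h₁ h₂ = linear-≈ (h₁ ⊞ (≈-sym h₂)) (solve (x ∷ b ∷ y ∷ a ∷ q ∷ e₁ ∷ []))

    -- The graph of a lift and its odd girth

    Vertex : Set
    Vertex = Fin (p * size)

    vertex : ℕ → Fin size → Vertex
    vertex x c = combine (x mod p) c

    pos : Vertex → ℕ
    pos u = toℕ (proj₁ (remQuot {p} size u))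

    sheet : Vertex → Fin size
    sheet u = proj₂ (remQuot {p} size u)

    toℕ-mod : ∀ x → toℕ (x mod p) ≡ x % p
    toℕ-mod x = toℕ-fromℕ< (m%n<n x p)

    pos-vertex : ∀ x c → pos (vertex x c) ≈ x
    pos-vertex x c = ≈-trans (≈-reflexive (trans (cong (toℕ ∘ proj₁) (remQuot-combine (x mod p) c))
        (toℕ-mod x))) (%-≈ x)

    sheet-vertex : ∀ x c → sheet (vertex x c) ≡ c
    sheet-vertex x c = cong proj₂ (remQuot-combine (x mod p) c)

    vertex-cong : ∀ {x y} c → x ≈ y → vertex x c ≡ vertex y c
    vertex-cong {x} {y} c x≈y = cong (λ z → combine z c)
      (toℕ-injective (trans (toℕ-mod x) (trans (≈⇒%≡ x≈y) (sym (toℕ-mod y)))))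

    vertex-pos-sheet : ∀ u → vertex (pos u) (sheet u) ≡ u
    vertex-pos-sheet u = trans (cong (λ z → combine z (sheet u))
        (toℕ-injective (trans (toℕ-mod (pos u)) (m<n⇒m%n≡m (toℕ<n (proj₁ (remQuot {p} size u)))))))
      (combine-remQuot {p} size u)

    vertex-≡ : ∀ {u x c} → pos u ≈ x → sheet u ≡ c → u ≡ vertex x c
    vertex-≡ {u} pos≈ refl = trans (sym (vertex-pos-sheet u)) (vertex-cong (sheet u) pos≈)

    neighbour : Vertex → Fin (suc e) → Vertex
    neighbour u k = vertex (pos u + q + toℕ k) (proj₁ (transport (pos u) (toℕ k) (sheet u)))

    toℕ≤e : (k : Fin (suc e)) → toℕ k ≤ e
    toℕ≤e k = s≤s⁻¹ (toℕ<n k)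

    VertexLink : Vertex → Vertex → Set
    VertexLink u v = Link (pos u) (sheet u) (pos v) (sheet v)

    neighbour⇒link : ∀ u k → VertexLink u (neighbour u k)
    neighbour⇒link u k = link (toℕ k) (toℕ≤e k) (pos-vertex _ _)
      (subst (Transport (pos u) (toℕ k) (sheet u)) (sym (sheet-vertex _ _)) (proj₂ (transport (pos u) (toℕ k)
          (sheet u))))

    link⇒neighbour : ∀ u v → VertexLink u v → ∃ λ k → neighbour u k ≡ v
    link⇒neighbour u v (link j j≤e y≈ t) = fromℕ< (s≤s j≤e) , sym (vertex-≡
        (≈-trans y≈ (≈-reflexive (cong (pos u + q +_) (sym j≡))))
        (Transport-unique (subst (λ j → Transport (pos u) j (sheet u) (sheet v)) (sym j≡) t)
          (proj₂ (transport (pos u) _ (sheet u)))))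
      where
      j≡ : toℕ (fromℕ< (s≤s j≤e)) ≡ j
      j≡ = toℕ-fromℕ< (s≤s j≤e)

    neighbour-injective : ∀ u → Injective _≡_ _≡_ (neighbour u)
    neighbour-injective u {k} {l} h = toℕ-injective (step-unique {pos u} {pos (neighbour u k)}
      (pos-vertex _ _) (≈-trans (≈-reflexive (cong pos h)) (pos-vertex _ _)) (toℕ≤e k) (toℕ≤e l))

    neighbour-irreflexive : ∀ u k → neighbour u k ≢ u
    neighbour-irreflexive u k h = near-nonadjacent {pos u} {pos u} 0 0 ≈-refl z≤n z≤n (toℕ≤e k)
      (≈-trans (≈-reflexive (cong pos (sym h))) (pos-vertex _ _))

    open FromNeighbours neighbour neighbour-injective
      (λ u k → link⇒neighbour _ _ (Link-sym (neighbour⇒link u k))) neighbour-irreflexive public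

    edge⇒link : ∀ {u v} → Edge graph u v → VertexLink u v
    edge⇒link {u} {v} uv = subst (VertexLink u) (proj₂ (adjacent⁻ uv)) (neighbour⇒link u (proj₁ (adjacent⁻ uv)))

    link⇒edge : ∀ {x c y c′} → Link x c y c′ → Edge graph (vertex x c) (vertex y c′)
    link⇒edge {x} {c} {y} {c′} l = adjacent⁺ {vertex x c} {vertex y c′} (link⇒neighbour _ _
      (lemma (sheet-vertex x c) (sheet-vertex y c′) (Link-resp (≈-sym (pos-vertex x c)) (≈-sym
          (pos-vertex y c′)) l)))
      where
      lemma : ∀ {x y d d′} → d ≡ c → d′ ≡ c′ → Link x c y c′ → Link x d y d′
      lemma refl refl l = l

    path-reach : ∀ m (v : Fin (suc m) → Vertex) → (∀ i → Edge graph (v (inject₁ i)) (v (suc i))) →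
      Reach m (pos (v zero)) (pos (v (fromℕ m)))
    path-reach zero v edges = Reach-refl ≈-refl
    path-reach (suc m) v edges = Reach-trans (Adj⇒Reach (Link⇒Adj (edge⇒link {v zero} {v (suc zero)}
        (edges zero))))
      (path-reach m (v ∘ suc) (edges ∘ suc))

    -- Forgetting the sheets turns an odd cycle into an odd closed walk in the circular clique, to
    -- which `odd-closed` applies.
    odd-cycle-bound : ∀ k → Odd k → HasCycleOfLength graph k → suc (2 * suc r) ≤ k
    odd-cycle-bound (suc .(2 * l)) (l , refl) (_ , v , _ , edges , closing) = s≤s (*-monoʳ-≤ 2
      (odd-closed l (subst (λ k → Reach k (pos (v zero)) (pos (v zero))) (lemma l)
        (Reach-trans (path-reach (2 * l) v edges) (Adj⇒Reach (Link⇒Adj (edge⇒link {v (fromℕ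
            (2 * l))} {v zero} closing))))) ≈-refl))
      where
      lemma : ∀ l → 2 * l + 1 ≡ suc (l + l)
      lemma = solve-∀

    -- After 2r + 2 rim steps from 2 the position is 2 + q + 1, a neighbour of 2. The start 2 is not
    -- a chord end, so the closing edge stays in the sheet.
    rim-cycle : Fin size → HasCycleOfLength graph (suc (2 * suc r))
    rim-cycle c = (linear-≤ (z≤n {0}) (2 * r) (solve (r ∷ []))) , v , v-injective , edges , closing-edge
      where
      v : Fin (suc (2 * suc r)) → Vertex
      v i = vertex (2 + toℕ i * q) c
      advance : ∀ i → 2 + i * q + q ≈ 2 + suc i * q
      advance i = linear-≈ (≈-refl {0}) (solve (i ∷ q ∷ []))
      1≤e : 1 ≤ e
      1≤e = ≤-trans (n≤1+n 1) 2≤e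
      2-unblocked : ¬ Blocked 2
      2-unblocked = unblocked {2} ≤-refl (linear-≤ (2≤e ⊕ 2≤e ⊕ 2e<q) (1 + e) (solve (q ∷ e ∷ [])))
      closing : ∀ {m} → m ≡ 2 * suc r → 2 + q + 1 ≈ 2 + m * q
      closing refl = linear-≈ (≈-sym kq≈1) (solve (q ∷ r ∷ []))
      edges : ∀ i → Edge graph (v (inject₁ i)) (v (suc i))
      edges i = link⇒edge {2 + toℕ (inject₁ i) * q} {c} {2 + toℕ (suc i) * q} {c}
        (Link-resp (lemma (toℕ-inject₁ i)) (advance (toℕ i)) (link-rim (2 + toℕ i * q) c))
        where
        lemma : ∀ {i i′} → i′ ≡ i → 2 + i * q ≈ 2 + i′ * q
        lemma refl = ≈-refl
      closing-edge : Edge graph (v (fromℕ (2 * suc r))) (v zero)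
      closing-edge = link⇒edge {2 + toℕ (fromℕ (2 * suc r)) * q} {c} {2 + 0 * q} {c}
        (Link-resp (closing (toℕ-fromℕ (2 * suc r))) ≈-refl (Link-sym (link-free c 1≤e 2-unblocked)))
      -- Multiplying by 2r + 1, the inverse of q, cancels q; the indices are at most 2r + 2 and
      -- hence less than p.
      cancel : ∀ i j → 2 + i * q ≈ 2 + j * q → i ≤ 2 * suc r → j ≤ 2 * suc r → i ≡ j
      cancel i j h i≤ j≤ = ≈⇒≡
        (linear-≈ ((≈-sym ((i * ((r + r + 1) * q) ≈ i * 1) ∋ multiple-≈ i kq≈1)) ⊞ ((j *
            ((r + r + 1) * q) ≈ j * 1) ∋ multiple-≈ j kq≈1) ⊞ (((r + r + 1) * (2 + i * q) ≈ (r + r + 1) *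
            (2 + j * q)) ∋ multiple-≈ (r + r + 1) h)) (solve (i ∷ j ∷ r ∷ q ∷ [])))
        (linear-≤ (i≤ ⊕ (≤-reflexive p≡) ⊕ (≤-reflexive (sym q≡)) ⊕ ((r * 2 ≤ r * e) ∋ *-monoʳ-≤ r 2≤e) ⊕ 2≤e)
            (j + q) (solve (i ∷ j ∷ p ∷ r ∷ q ∷ e ∷ [])))
        (linear-≤ (j≤ ⊕ (≤-reflexive p≡) ⊕ (≤-reflexive (sym q≡)) ⊕ ((r * 2 ≤ r * e) ∋ *-monoʳ-≤ r 2≤e) ⊕ 2≤e)
            (i + q) (solve (j ∷ i ∷ p ∷ r ∷ q ∷ e ∷ [])))
      v-injective : Injective _≡_ _≡_ v
      v-injective {i} {j} h = toℕ-injective (cancel (toℕ i) (toℕ j)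
        (≈-trans (≈-sym (pos-vertex _ c)) (≈-trans (≈-reflexive (cong pos h)) (pos-vertex _ c)))
        (s≤s⁻¹ (toℕ<n i)) (s≤s⁻¹ (toℕ<n j)))

    oddGirth : Fin size → OddGirth graph (suc (2 * suc r))
    oddGirth c = ((suc r , refl) , rim-cycle c) , odd-cycle-bound

  -- Affine maps compatible with the chords

  end : Bool → Bool → ℕ
  end false = P
  end true  = Q

  -- o tells whether the ends P i and Q i of the chords are exchanged, s whether the two chords are.
  record Typed (F : ℕ → ℕ) (o s : Bool) : Set where
    field
      P-image  : ∀ i → F (P i) ≈ end o (s xor i)
      Q-image  : ∀ i → F (Q i) ≈ end (not o) (s xor i)
      identity : o ≡ false → s ≡ false → ∀ x → F x ≈ x

  -- Applied to the preimages of 0 and 1, this leaves two candidates among the rotations and two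
  -- among the reflections.
  consecutive-blocked : ∀ {x} → Blocked x → Blocked (x + 1) → x ≈ 0 ⊎ x ≈ q + e₁
  consecutive-blocked {x} = go
    where
    equal : ∀ b b′ → x ≈ b → x + 1 ≈ b′ → b ≤ q + e → b′ ≤ q + e → b + 1 ≡ b′
    equal b b′ x≈ x+1≈ b≤ b′≤ = ≈⇒≡ (linear-≈ ((≈-sym x≈) ⊞ x+1≈) (solve (b ∷ b′ ∷ x ∷ [])))
      (linear-≤ (b≤ ⊕ (≤-reflexive p≡) ⊕ 2e<q ⊕ 2≤e) (1 + b′ + e) (solve (b ∷ b′ ∷ p ∷ q ∷ e ∷ [])))
      (linear-≤ (b′≤ ⊕ (≤-reflexive p≡)) (b + q) (solve (b′ ∷ b ∷ p ∷ q ∷ e ∷ [])))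
    low≤ : ∀ {b} → b ≤ 1 → b ≤ q + e
    low≤ {b} b≤1 = linear-≤ (b≤1 ⊕ 2≤e) (1 + q) (solve (b ∷ q ∷ e ∷ []))
    low-low : ∀ b b′ → x ≈ b → b′ ≤ 1 → b + 1 ≡ b′ → x ≈ 0
    low-low b b′ x≈ b′≤ h = ≈-trans x≈ (≈-reflexive (n≤0⇒n≡0 (linear-≤ (b′≤ ⊕ (≤-reflexive h)) 0
        (solve (b ∷ b′ ∷ [])))))
    low-high : ∀ b b′ → b ≤ 1 → q + e ≤ b′ + 1 → ¬ b + 1 ≡ b′
    low-high b b′ b≤ ≤b′ h = linear-⊥ (b≤ ⊕ ≤b′ ⊕ (≤-reflexive (sym h)) ⊕ 2e<q ⊕ 2≤e ⊕ 2≤e) (1 + e)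
        (solve (b ∷ q ∷ e ∷ b′ ∷ []))
    high-low : ∀ b b′ → q + e ≤ b + 1 → b′ ≤ 1 → ¬ b + 1 ≡ b′
    high-low b b′ ≤b b′≤ h = linear-⊥ (≤b ⊕ b′≤ ⊕ (≤-reflexive h) ⊕ 2≤e) q (solve (q ∷ e ∷ b ∷ b′ ∷ []))
    high-high : ∀ b b′ → x ≈ b → q + e ≤ b + 1 → b′ ≤ q + e → b + 1 ≡ b′ → x ≈ q + e₁
    high-high b b′ x≈ ≤b b′≤ h = ≈-trans x≈ (≈-reflexive (≤-antisym
      (linear-≤ (b′≤ ⊕ (≤-reflexive h) ⊕ (≤-reflexive (sym e≡))) 0 (solve (b ∷ q ∷ e₁ ∷ b′ ∷ e ∷ []))) (linear-≤
          (≤b ⊕ (≤-reflexive e≡)) 0 (solve (q ∷ e₁ ∷ b ∷ e ∷ [])))))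
    go : Blocked x → Blocked (x + 1) → x ≈ 0 ⊎ x ≈ q + e₁
    go (low b x≈ b≤) (low b′ x+1≈ b′≤) = inj₁ (low-low b b′ x≈ b′≤ (equal b b′ x≈ x+1≈ (low≤ b≤) (low≤ b′≤)))
    go (low b x≈ b≤) (high b′ x+1≈ ≤b′ b′≤) = ⊥-elim (low-high b b′ b≤ ≤b′ (equal b b′ x≈ x+1≈ (low≤ b≤) b′≤))
    go (high b x≈ ≤b b≤) (low b′ x+1≈ b′≤) = ⊥-elim (high-low b b′ ≤b b′≤ (equal b b′ x≈ x+1≈ b≤ (low≤ b′≤)))
    go (high b x≈ ≤b b≤) (high b′ x+1≈ _ b′≤) = inj₂ (high-high b b′ x≈ ≤b b′≤ (equal b b′ x≈ x+1≈ b≤ b′≤))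

  e₁-blocked : Blocked e₁ → e₁ ≡ 1
  e₁-blocked b = ≤-antisym (≤1 b) (linear-≤ ((≤-reflexive (sym e≡)) ⊕ 2≤e) 0 (solve (e₁ ∷ e ∷ [])))
    where
    ≤1 : Blocked e₁ → e₁ ≤ 1
    ≤1 (low b e₁≈ b≤) = subst (_≤ 1) (sym (≈⇒≡ e₁≈ (linear-≤ ((≤-reflexive e≡) ⊕ (≤-reflexive p≡)) (b + 2 * q)
        (solve (e₁ ∷ b ∷ p ∷ e ∷ q ∷ [])))
      (linear-≤ (b≤ ⊕ 2≤e ⊕ (≤-reflexive p≡)) (e₁ + 2 * q) (solve (b ∷ e₁ ∷ p ∷ e ∷ q ∷ []))))) b≤
    ≤1 (high b e₁≈ ≤b b≤) = ⊥-elim (linear-⊥ (≤b ⊕ (≤-reflexive (sym e₁≡b)) ⊕ (≤-reflexive e≡) ⊕ 2e<q) (2 * e)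
        (solve (q ∷ e ∷ b ∷ e₁ ∷ [])))
      where
      e₁≡b : e₁ ≡ b
      e₁≡b = ≈⇒≡ e₁≈ (linear-≤ ((≤-reflexive e≡) ⊕ (≤-reflexive p≡)) (b + 2 * q)
          (solve (e₁ ∷ b ∷ p ∷ e ∷ q ∷ [])))
        (linear-≤ (b≤ ⊕ (≤-reflexive p≡) ⊕ 2e<q) (2 * e + e₁) (solve (b ∷ e₁ ∷ p ∷ q ∷ e ∷ [])))

  q+1-blocked : Blocked (q + 1) → e₁ ≡ 1
  q+1-blocked b = ≤-antisym (≤1 b) (linear-≤ ((≤-reflexive (sym e≡)) ⊕ 2≤e) 0 (solve (e₁ ∷ e ∷ [])))
    where
    ≤1 : Blocked (q + 1) → e₁ ≤ 1
    ≤1 (low b q+1≈ b≤) = ⊥-elim (linear-⊥ (b≤ ⊕ (≤-reflexive q+1≡b) ⊕ 2e<q) (2 * e) (solve (b ∷ q ∷ e ∷ [])))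
      where
      q+1≡b : q + 1 ≡ b
      q+1≡b = ≈⇒≡ q+1≈ (linear-≤ ((≤-reflexive p≡) ⊕ 2≤e) (b + q) (solve (q ∷ b ∷ p ∷ e ∷ [])))
        (linear-≤ (b≤ ⊕ 2≤e ⊕ (≤-reflexive p≡)) (1 + 3 * q) (solve (b ∷ q ∷ p ∷ e ∷ [])))
    ≤1 (high b q+1≈ ≤b b≤) = linear-≤ (≤b ⊕ (≤-reflexive (sym q+1≡b)) ⊕ (≤-reflexive e≡)) 0
        (solve (e₁ ∷ q ∷ e ∷ b ∷ []))
      where
      q+1≡b : q + 1 ≡ b
      q+1≡b = ≈⇒≡ q+1≈ (linear-≤ ((≤-reflexive p≡) ⊕ 2≤e) (b + q) (solve (q ∷ b ∷ p ∷ e ∷ [])))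
        (linear-≤ (b≤ ⊕ (≤-reflexive p≡)) (2 * q) (solve (b ∷ q ∷ p ∷ e ∷ [])))

  P+P-not : ∀ i → P i + P (not i) ≡ 1
  P+P-not false = refl
  P+P-not true  = refl

  -- The four candidates are x, x - (q + e - 1), 1 - x and q + e - x. The second and third are
  -- compatible with the chords only for e = 2, which the preimage of `Q true` reveals.
  classify : ∀ {F} → Affine F → (∀ i u → F u ≈ P i → Blocked u) → (∀ i u → F u ≈ Q i → Blocked u) →
    ∃ λ o → ∃ λ s → Typed F o s
  classify {F} (rotation a F≈) P-blocked′ Q-blocked′ = [ unmoved , turned ]′
      (consecutive-blocked (P-blocked′ false b (≈-trans (F≈ b) (neg-inverse a)))
                           (P-blocked′ true (b + 1) (≈-trans (F≈ (b + 1)) (shift 1 a+b≈0))))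
    where
    b : ℕ
    b = neg a
    a+b≈0 : a + b ≈ 0
    a+b≈0 = neg-inverse a
    shift : ∀ {b} c → a + b ≈ 0 → a + (b + c) ≈ c
    shift {b} c h = linear-≈ h (solve (a ∷ b ∷ c ∷ []))
    unmoved : b ≈ 0 → ∃ λ o → ∃ λ s → Typed F o s
    unmoved b≈0 = false , false , record { P-image = λ i → F-id (P i) ; Q-image = λ i → F-id (Q i) ; identity =
        λ _ _ → F-id }
      where
      cancel : ∀ {b y} x → a + b ≈ 0 → b ≈ 0 → y ≈ a + x → y ≈ x
      cancel {b} {y} x h₁ h₂ h₃ = linear-≈ (h₁ ⊞ (≈-sym h₂) ⊞ h₃) (solve (y ∷ x ∷ a ∷ b ∷ []))
      F-id : ∀ x → F x ≈ x
      F-id x = cancel x a+b≈0 b≈0 (F≈ x)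
    turned : b ≈ q + e₁ → ∃ λ o → ∃ λ s → Typed F o s
    turned b≈ = true , false , record
        { P-image = λ i → to-Q (P i) a+b≈0 b≈ e₁≡1 (F≈ (P i))
        ; Q-image = λ i → to-P (P i) a+b≈0 b≈ (F≈ (Q i))
        ; identity = λ ()
        }
      where
      -- The preimage of `Q true` is congruent to e - 1.
      e₁≡1 : e₁ ≡ 1
      e₁≡1 = e₁-blocked (Blocked-resp (lemma b≈) (Q-blocked′ true (b + Q true) (≈-trans (F≈ _) (shift
          (Q true) a+b≈0))))
        where
        lemma : ∀ {b} → b ≈ q + e₁ → b + (q + e₁ + 1) ≈ e₁
        lemma {b} h = linear-≈ (h ⊞ (≈-reflexive e≡) ⊞ p≈0) (solve (b ∷ q ∷ e₁ ∷ e ∷ []))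
      to-Q : ∀ {b y} x → a + b ≈ 0 → b ≈ q + e₁ → e₁ ≡ 1 → y ≈ a + x → y ≈ q + e₁ + x
      to-Q {b} {y} x h₁ h₂ h₃ h₄ = linear-≈ (h₁ ⊞ (≈-sym h₂) ⊞ (≈-reflexive (sym h₃)) ⊞ h₄ ⊞ (≈-reflexive
          (sym e≡)) ⊞ (≈-sym p≈0)) (solve (y ∷ q ∷ e₁ ∷ x ∷ a ∷ b ∷ e ∷ []))
      to-P : ∀ {b y} x → a + b ≈ 0 → b ≈ q + e₁ → y ≈ a + (q + e₁ + x) → y ≈ x
      to-P {b} {y} x h₁ h₂ h₃ = linear-≈ (h₁ ⊞ (≈-sym h₂) ⊞ h₃) (solve (y ∷ x ∷ a ∷ b ∷ q ∷ e₁ ∷ []))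
  classify {F} (reflection a F≈) P-blocked′ Q-blocked′ = [ swapped , crossed ]′
      (consecutive-blocked (P-blocked′ true w (lemma (F≈ w) w+1≈a))
                           (Blocked-resp (≈-sym w+1≈a) (P-blocked′ false a (lemma₀ (F≈ a)))))
    where
    w : ℕ
    w = a + neg 1
    w+1≈a : w + 1 ≈ a
    w+1≈a = lemma (neg-inverse 1)
      where
      lemma : ∀ {b} → 1 + b ≈ 0 → a + b + 1 ≈ a
      lemma {b} h = linear-≈ h (solve (a ∷ b ∷ []))
    lemma : ∀ {w y} → y + w ≈ a → w + 1 ≈ a → y ≈ 1
    lemma {w} {y} h₁ h₂ = linear-≈ (h₁ ⊞ (≈-sym h₂)) (solve (y ∷ w ∷ a ∷ []))
    lemma₀ : ∀ {y} → y + a ≈ a → y ≈ 0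
    lemma₀ {y} h = linear-≈ h (solve (y ∷ a ∷ []))
    swapped : w ≈ 0 → ∃ λ o → ∃ λ s → Typed F o s
    swapped w≈0 = false , true , record
        { P-image = λ i → to-P w≈0 w+1≈a (P+P-not i) (F≈ (P i))
        ; Q-image = λ i → to-Q w≈0 w+1≈a (P+P-not i) e₁≡1 (F≈ (Q i))
        ; identity = λ _ ()
        }
      where
      v : ℕ
      v = a + neg (Q true)
      -- The preimage of `Q true` is congruent to q + 1.
      e₁≡1 : e₁ ≡ 1
      e₁≡1 = q+1-blocked (Blocked-resp (lemma₁ w≈0 w+1≈a (neg-inverse (Q true)))
          (Q-blocked′ true v (lemma₂ (F≈ v) (neg-inverse (Q true)))))
        where
        lemma₁ : ∀ {w b} → w ≈ 0 → w + 1 ≈ a → q + e₁ + 1 + b ≈ 0 → a + b ≈ q + 1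
        lemma₁ {w} {b} h₁ h₂ h₃ = linear-≈ (h₁ ⊞ (≈-sym h₂) ⊞ h₃ ⊞ (≈-reflexive (sym e≡)) ⊞ (≈-sym p≈0))
            (solve (a ∷ b ∷ q ∷ w ∷ e₁ ∷ e ∷ []))
        lemma₂ : ∀ {y b} → y + (a + b) ≈ a → q + e₁ + 1 + b ≈ 0 → y ≈ q + e₁ + 1
        lemma₂ {y} {b} h₁ h₂ = linear-≈ (h₁ ⊞ (≈-sym h₂)) (solve (y ∷ q ∷ e₁ ∷ a ∷ b ∷ []))
      to-P : ∀ {w x x′ y} → w ≈ 0 → w + 1 ≈ a → x + x′ ≡ 1 → y + x ≈ a → y ≈ x′
      to-P {w} {x} {x′} {y} h₁ h₂ h₃ h₄ = linear-≈ (h₁ ⊞ (≈-sym h₂) ⊞ (≈-reflexive (sym h₃)) ⊞ h₄)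
          (solve (y ∷ x′ ∷ w ∷ a ∷ x ∷ []))
      to-Q : ∀ {w x x′ y} → w ≈ 0 → w + 1 ≈ a → x + x′ ≡ 1 → e₁ ≡ 1 → y + (q + e₁ + x) ≈ a → y ≈ q + e₁ + x′
      to-Q {w} {x} {x′} {y} h₁ h₂ h₃ h₄ h₅ = linear-≈ (h₁ ⊞ (≈-sym h₂) ⊞ (≈-reflexive (sym h₃)) ⊞ (≈-reflexive
          (sym h₄)) ⊞ h₅ ⊞ (≈-reflexive (sym e≡)) ⊞ (≈-sym p≈0)) (solve (y ∷ q ∷ e₁ ∷ x′ ∷ w ∷ a ∷ x ∷ e ∷ []))
    crossed : w ≈ q + e₁ → ∃ λ o → ∃ λ s → Typed F o s
    crossed w≈ = true , true , record
        { P-image = λ i → to-Q w≈ w+1≈a (P+P-not i) (F≈ (P i))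
        ; Q-image = λ i → to-P w≈ w+1≈a (P+P-not i) (F≈ (Q i))
        ; identity = λ ()
        }
      where
      to-Q : ∀ {w x x′ y} → w ≈ q + e₁ → w + 1 ≈ a → x + x′ ≡ 1 → y + x ≈ a → y ≈ q + e₁ + x′
      to-Q {w} {x} {x′} {y} h₁ h₂ h₃ h₄ = linear-≈ (h₁ ⊞ (≈-sym h₂) ⊞ (≈-reflexive (sym h₃)) ⊞ h₄)
          (solve (y ∷ q ∷ e₁ ∷ x′ ∷ w ∷ a ∷ x ∷ []))
      to-P : ∀ {w x x′ y} → w ≈ q + e₁ → w + 1 ≈ a → x + x′ ≡ 1 → y + (q + e₁ + x) ≈ a → y ≈ x′
      to-P {w} {x} {x′} {y} h₁ h₂ h₃ h₄ = linear-≈ (h₁ ⊞ (≈-sym h₂) ⊞ (≈-reflexive (sym h₃)) ⊞ h₄)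
          (solve (y ∷ x′ ∷ w ∷ q ∷ e₁ ∷ a ∷ x ∷ []))

  -- Homomorphisms between lifts

  module Homomorphism (S T : Sheets) (T-moves : ∀ i c → Sheets.σ T i c ≢ c)
    (f : Lift.Vertex S → Lift.Vertex T) (f-hom : IsHom (Lift.graph S) (Lift.graph T) f) where

    private
      open Sheets S using (size; σ)
      module S = Lift S
      module T = Lift T

    F : Fin size → ℕ → ℕ
    F c x = T.pos (f (S.vertex x c))

    sheet-at : Fin size → ℕ → Fin (Sheets.size T)
    sheet-at c x = T.sheet (f (S.vertex x c))

    image-link : ∀ {x c y c′} → S.Link x c y c′ → T.Link (F c x) (sheet-at c x) (F c′ y) (sheet-at c′ y)
    image-link {x} {c} {y} {c′} l = T.edge⇒link {f (S.vertex x c)} {f (S.vertex y c′)} (f-hom (S.vertex x c)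
        (S.vertex y c′) (S.link⇒edge {x} {c} {y} {c′} l))

    F-safe : ∀ c → SafeHom (F c)
    F-safe c = record
      { resp = λ x≈y → ≈-reflexive (cong (T.pos ∘ f) (S.vertex-cong c x≈y))
      ; rim  = λ x → T.Link⇒Adj (image-link (S.link-rim x c))
      ; free = λ x j j≤e ¬b → T.Link⇒Adj (image-link (S.link-free c j≤e ¬b))
      }

    F-affine : ∀ c → Affine (F c)
    F-affine c = affine (F-safe c)

    -- Rotations and reflections map rim edges to rim edges, and these never change the sheet.
    sheet-at-rim : ∀ c x → sheet-at c (x + q) ≡ sheet-at c x
    sheet-at-rim c x = by-affinity (F-affine c)
      where
      by-affinity : Affine (F c) → sheet-at c (x + q) ≡ sheet-at c x
      by-affinity (rotation a F≈) = T.link-rim⁻ (lemma (F≈ x) (F≈ (x + q))) (image-link (S.link-rim x c))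
        where
        lemma : ∀ {y z} → y ≈ a + x → z ≈ a + (x + q) → z ≈ y + q
        lemma {y} {z} h₁ h₂ = linear-≈ ((≈-sym h₁) ⊞ h₂) (solve (z ∷ y ∷ q ∷ a ∷ x ∷ []))
      by-affinity (reflection a F≈) = sym (T.link-rim⁻ (lemma (F≈ x) (F≈ (x + q))) (T.Link-sym (image-link
          (S.link-rim x c))))
        where
        lemma : ∀ {y z} → y + x ≈ a → z + (x + q) ≈ a → y ≈ z + q
        lemma {y} {z} h₁ h₂ = linear-≈ (h₁ ⊞ (≈-sym h₂)) (solve (y ∷ z ∷ q ∷ x ∷ a ∷ []))

    sheet-at-rims : ∀ c m x → sheet-at c (x + m * q) ≡ sheet-at c x
    sheet-at-rims c zero x = cong (sheet-at c) (+-identityʳ x)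
    sheet-at-rims c (suc m) x = trans (cong (sheet-at c) (sym (+-assoc x q (m * q))))
      (trans (sheet-at-rims c m (x + q)) (sheet-at-rim c x))

    sheet-image : Fin size → Fin (Sheets.size T)
    sheet-image c = sheet-at c 0

    -- Since 2r + 1 rim steps advance by one vertex, the rim edges connect the whole sheet.
    sheet-at-constant : ∀ c x → sheet-at c x ≡ sheet-image c
    sheet-at-constant c zero = refl
    sheet-at-constant c (suc x) = trans (cong (T.sheet ∘ f) (S.vertex-cong c around))
        (trans (sheet-at-rims c (r + r + 1) x) (sheet-at-constant c x))
      where
      around : suc x ≈ x + (r + r + 1) * q
      around = linear-≈ (≈-sym kq≈1) (solve (x ∷ r ∷ q ∷ []))

    sheet-link : ∀ {x c y c′} → S.Link x c y c′ → T.Link (F c x) (sheet-image c) (F c′ y) (sheet-image c′)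
    sheet-link {x} {c} {y} {c′} l = lemma (sheet-at-constant c x) (sheet-at-constant c′ y) (image-link l)
      where
      lemma : ∀ {x y d d′ d₁ d₁′} → d ≡ d₁ → d′ ≡ d₁′ → T.Link x d y d′ → T.Link x d₁ y d₁′
      lemma refl refl l = l

    e₁≤e : e₁ ≤ e
    e₁≤e = ≤-trans (n≤1+n e₁) (≤-reflexive e≡)

    -- An edge inside a sheet cannot be mapped onto a chord, which changes the sheet.
    P-preimage-blocked : ∀ c i u → F c u ≈ P i → Blocked u
    P-preimage-blocked c i u Fu≈ =
        decidable-stable (blocked? u) λ ¬b → T-moves i (sheet-image c) (sym (by-affinity ¬b (F-affine c)))
      where
      by-affinity : ¬ Blocked u → Affine (F c) → sheet-image c ≡ Sheets.σ T i (sheet-image c)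
      -- The neighbour of u sent to `Q i` has offset e - 1 for a rotation and offset 1 for a
      -- reflection, which reverses offsets.
      by-affinity ¬b (rotation a F≈) = T.link-chord⁻ i Fu≈ (≈-trans (lemma (F≈ u) (F≈ (u + q + e₁)) Fu≈)
          (P+q+e₁≈Q i))
          (sheet-link (S.link-free c e₁≤e ¬b))
        where
        lemma : ∀ {y z b} → y ≈ a + u → z ≈ a + (u + q + e₁) → y ≈ b → z ≈ b + q + e₁
        lemma {y} {z} {b} h₁ h₂ h₃ = linear-≈ ((≈-sym h₁) ⊞ h₂ ⊞ h₃) (solve (z ∷ b ∷ q ∷ e₁ ∷ y ∷ a ∷ u ∷ []))
      by-affinity ¬b (reflection a F≈) = T.link-chord⁻ i Fu≈ (≈-trans (lemma (F≈ u) (F≈ (u + q + 1)) Fu≈)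
          (P+q+e₁≈Q i))
          (sheet-link (S.link-free c (≤-trans (n≤1+n 1) 2≤e) ¬b))
        where
        lemma : ∀ {y z b} → y + u ≈ a → z + (u + q + 1) ≈ a → y ≈ b → z ≈ b + q + e₁
        lemma {y} {z} {b} h₁ h₂ h₃ = linear-≈ ((≈-sym h₁) ⊞ h₂ ⊞ h₃ ⊞ (≈-reflexive (sym e≡)) ⊞ (≈-sym p≈0))
            (solve (z ∷ b ∷ q ∷ e₁ ∷ y ∷ u ∷ a ∷ e ∷ []))

    Q-preimage-blocked : ∀ c i u → F c u ≈ Q i → Blocked u
    Q-preimage-blocked c i u Fu≈ =
        decidable-stable (blocked? u) λ ¬b → T-moves i (sheet-image c) (sym (by-affinity ¬b (F-affine c)))
      where
      by-affinity : ¬ Blocked u → Affine (F c) → sheet-image c ≡ Sheets.σ T i (sheet-image c)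
      by-affinity ¬b (rotation a F≈) = T.link-chord⁻ i (≈-trans (lemma (F≈ u) (F≈ (u + q + 1)) Fu≈)
          (Q+q+1≈P i)) Fu≈
          (T.Link-sym (sheet-link (S.link-free c (≤-trans (n≤1+n 1) 2≤e) ¬b)))
        where
        lemma : ∀ {y z b} → y ≈ a + u → z ≈ a + (u + q + 1) → y ≈ b → z ≈ b + q + 1
        lemma {y} {z} {b} h₁ h₂ h₃ = linear-≈ ((≈-sym h₁) ⊞ h₂ ⊞ h₃) (solve (z ∷ b ∷ q ∷ y ∷ a ∷ u ∷ []))
      by-affinity ¬b (reflection a F≈) = T.link-chord⁻ i (lemma (F≈ u) (F≈ (u + q + e₁)) Fu≈) Fu≈
          (T.Link-sym (sheet-link (S.link-free c e₁≤e ¬b)))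
        where
        lemma : ∀ {y z b} → y + u ≈ a → z + (u + q + e₁) ≈ a → y ≈ q + e₁ + b → z ≈ b
        lemma {y} {z} {b} h₁ h₂ h₃ = linear-≈ ((≈-sym h₁) ⊞ h₂ ⊞ h₃) (solve (z ∷ b ∷ y ∷ u ∷ a ∷ q ∷ e₁ ∷ []))

    abstract
      classified : ∀ c → ∃ λ o → ∃ λ s → Typed (F c) o s
      classified c = classify (F-affine c) (P-preimage-blocked c) (Q-preimage-blocked c)

    o s : Fin size → Bool
    o c = proj₁ (classified c)
    s c = proj₁ (proj₂ (classified c))

    typed : ∀ c → Typed (F c) (o c) (s c)
    typed c = proj₂ (proj₂ (classified c))

    -- If `o` differed on the two sheets, the chord would join two P ends or two Q ends, which are
    -- never adjacent. If `s` agrees, the image is a chord; otherwise it joins ends of different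
    -- chords.
    sheet-step : ∀ c i → Step (Sheets.σ T) (o c) (o (σ i c)) (s c) (s (σ i c)) i (sheet-image c) (sheet-image
        (σ i c))
    sheet-step c i = by-type (o c) (o (σ i c)) (s c) (s (σ i c))
        (Typed.P-image (typed c) i) (Typed.Q-image (typed (σ i c)) i) (sheet-link {P i} {c} {Q i} {σ i c}
            (S.link-chord i c))
      where
      xor-injective : ∀ s s′ i → s xor i ≡ s′ xor i → s ≡ s′
      xor-injective false false _ _ = refl
      xor-injective true true _ _ = refl
      xor-injective false true false ()
      xor-injective false true true ()
      xor-injective true false false ()
      xor-injective true false true ()
      by-type : ∀ o o′ s s′ {x y d d′} → x ≈ end o (s xor i) → y ≈ end (not o′) (s′ xor i) → T.Link x d y d′ →
        Step (Sheets.σ T) o o′ s s′ i d d′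
      by-type false true s s′ x≈ y≈ l = ⊥-elim (T.link-PP⁻ (s xor i) (s′ xor i) x≈ y≈ l)
      by-type true false s s′ x≈ y≈ l = ⊥-elim (T.link-QQ⁻ (s xor i) (s′ xor i) x≈ y≈ l)
      by-type false false s s′ x≈ y≈ l = case s Bool.≟ s′ of λ where
        (yes refl) → forward refl (T.link-chord⁻ (s xor i) x≈ y≈ l)
        (no s≢s′)  → fold s≢s′ (T.link-cross⁻ (s xor i) (s′ xor i) (s≢s′ ∘ xor-injective s s′ i) x≈ y≈ l)
      by-type true true s s′ x≈ y≈ l = case s Bool.≟ s′ of λ where
        (yes refl) → backward refl (T.link-chord⁻ (s xor i) y≈ x≈ (T.Link-sym l))
        (no s≢s′)  → fold s≢s′ (sym (T.link-cross⁻ (s′ xor i) (s xor i)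
            (s≢s′ ∘ sym ∘ xor-injective s′ s i) y≈ x≈ (T.Link-sym l)))

    image-fixed : ∀ u → o (S.sheet u) ≡ false → s (S.sheet u) ≡ false →
      f u ≡ T.vertex (S.pos u) (sheet-image (S.sheet u))
    image-fixed u o≡ s≡ = trans (cong f (sym (S.vertex-pos-sheet u)))
      (T.vertex-≡ {f (S.vertex (S.pos u) (S.sheet u))} {S.pos u} (Typed.identity (typed (S.sheet u)) o≡ s≡
          (S.pos u)) (sheet-at-constant (S.sheet u) (S.pos u)))

  -- The family of graphs

  G : ℕ → Graph
  G i = Lift.graph (sheets i)

  module _ {i j : ℕ} (f : Lift.Vertex (sheets i) → Lift.Vertex (sheets j)) (f-hom : IsHom (G i) (G j) f) where
    private
      module Hf = Homomorphism (sheets i) (sheets j) (perm-moves {j}) f f-hom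
      module Gi = Lift (sheets i)
      module Gj = Lift (sheets j)

    sheet-map-rigid : i ≡ j × (∀ c → Hf.o c ≡ false) × (∀ c → Hf.s c ≡ false) × (∀ c → toℕ
        (Hf.sheet-image c) ≡ toℕ c)
    sheet-map-rigid = SheetMap.rigid {i} {j} Hf.o Hf.s Hf.sheet-image Hf.sheet-step

    same-index : i ≡ j
    same-index = proj₁ sheet-map-rigid

    toℕ-sheet-image : ∀ c → toℕ (Hf.sheet-image c) ≡ toℕ c
    toℕ-sheet-image = proj₂ (proj₂ (proj₂ sheet-map-rigid))

    image : ∀ u → f u ≡ Gj.vertex (Gi.pos u) (Hf.sheet-image (Gi.sheet u))
    image u = Hf.image-fixed u (proj₁ (proj₂ sheet-map-rigid) (Gi.sheet u)) (proj₁ (proj₂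
        (proj₂ sheet-map-rigid)) (Gi.sheet u))

  G-rigid : ∀ i → Rigid (G i)
  G-rigid i f f-hom u = begin
    f u                                                      ≡⟨ image {i} {i} f f-hom u ⟩
    Gi.vertex (Gi.pos u) (Hf.sheet-image (Gi.sheet u))        ≡⟨ cong (Gi.vertex (Gi.pos u)) (toℕ-injective
        (toℕ-sheet-image {i} {i} f f-hom (Gi.sheet u))) ⟩
    Gi.vertex (Gi.pos u) (Gi.sheet u)                        ≡⟨ Gi.vertex-pos-sheet u ⟩
    u                                                        ∎
    where
    open ≡-Reasoning
    module Hf = Homomorphism (sheets i) (sheets i) (perm-moves {i}) f f-hom
    module Gi = Lift (sheets i)

  G-mutuallyRigid : MutuallyRigid G
  G-mutuallyRigid = G-rigid , λ i j i≢j (f , f-hom) → i≢j (same-index {i} {j} f f-hom)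

  G-regular : ∀ i → Regular (suc e) (G i)
  G-regular i = Lift.regular (sheets i)

  G-oddGirth : ∀ i → OddGirth (G i) (suc (2 * suc r))
  G-oddGirth i = Lift.oddGirth (sheets i) zero

construction : ∀ e r → 2 ≤ e → 2 ≤ r → Σ (ℕ → Graph) λ G →
  MutuallyRigid G × (∀ i → Regular (suc e) (G i) × OddGirth (G i) (suc (2 * suc r)))
-- Matching on both numbers makes the modulus reduce to a successor, so that its `NonZero` instance
-- is found.
construction e@(suc e₁) r@(suc _) 2≤e 2≤r = G , G-mutuallyRigid , λ i → G-regular i , G-oddGirth i
  where
  q : ℕ
  q = r * e + 1
  open Circulant e₁ e r q (q + q + e) refl 2≤e 2≤r refl refl

theorem1p2 : ∀ (d g : ℕ) → 3 ≤ d → 7 ≤ g → Odd g →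
    Σ (ℕ → Graph) λ G →
    MutuallyRigid G × (∀ i → Regular d (G i) × OddGirth (G i) g)
theorem1p2 (suc e) _ (s≤s 2≤e) 7≤g (suc r , refl) = construction e r 2≤e (s≤s⁻¹ (*-cancelˡ-≤ 2 (s≤s⁻¹ 7≤g)))
theorem1p2 _ _ _ 7≤g (zero , refl) = ⊥-elim (<⇒≱ (s≤s (s≤s z≤n)) 7≤g)
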